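{- If a graph $G$ has a perfect matching, then $p(G)=1$, where $p(G)$ denotes the $P$-vertex covering number of $G$.
   Context: Graphs are finite, simple and undirected; a graph on $n\ge 1$ vertices has vertex set $[n]=\{1,\ldots,n\}$. For a real symmetric $n\times n$ matrix $A=(a_{ij})$, its support graph $G(A)$ is the graph with vertex set $[n]$ and edge set $\{\{i,j\}: i\neq j,\ a_{ij}\neq 0\}$ (diagonal entries play no role). For a graph $G$ on $n$ vertices, $S(G)=\{A\in\mathbb{R}^{n\times n}: A^{T}=A,\ G(A)=G\}$. For $i\in[n]$, $A(i)$ denotes the principal submatrix of $A$ obtained by deleting the $i$-th row and the $i$-th column. $m_A(\lambda)$ denotes the algebraic multiplicity of $\lambda$ as an eigenvalue of $A$ (equal to $0$ if $\lambda$ is not an eigenvalue). A vertex $i$ of $G$ is called a $P$-vertex of $A\in S(G)$ if $m_{A(i)}(0)-m_A(0)=1$. The $P$-vertex covering number $p(G)$ is the minimum cardinality $|\mathcal{A}|$ of a family $\mathcal{A}\subseteq S(G)$ of non-singular matrices such that every vertex of $G$ is a $P$-vertex of some $A\in\mathcal{A}$; if no such family exists, $p(G)=\infty$. (Thus $p(G)=1$ means that there is a single non-singular matrix in $S(G)$ for which every vertex of $G$ is a $P$-vertex.) -}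

module Defs where

open import Algebra.Bundles.Raw using (RawRing)
import Algebra.Definitions.RawMonoid as RawMonoidDefs
import Algebra.Definitions.RawSemiring as RawSemiringDefs
open import Data.Bool.Base using (if_then_else_)
open import Data.Fin.Base using (Fin; toℕ; punchIn) renaming (zero to fzero; suc to fsuc)
open import Data.Fin.Properties using () renaming (_≟_ to _≟ᶠ_)
open import Data.List.Base using (List; []; _∷_; map)
open import Data.Nat.Base using (ℕ; zero; suc; _⊔_) renaming (_≤_ to _≤ℕ_)
import Data.Nat.Properties as ℕₚ
open import Data.Product.Base using (∃; ∃-syntax; _×_; _,_)
open import Data.Product using (∃!)
open import Data.Rational.Base
  using (ℚ; 0ℚ; 1ℚ; ½; _<_; _≤_; ∣_∣; 1/_; Positive; NonZero; positive)
  renaming (_+_ to _+ℚ_; _*_ to _*ℚ_; _-_ to _-ℚ_; -_ to -ℚ_)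
import Data.Rational.Properties as ℚₚ
open import Data.Rational.Solver using (module +-*-Solver)
open import Data.Vec.Functional using (Vector)
open import Function.Bundles using (_⇔_)
open import Level using (0ℓ)
open import Relation.Binary.Core using (Rel)
open import Relation.Binary.Definitions using (Symmetric; Irreflexive; Decidable)
open import Relation.Binary.PropositionalEquality
  using (_≡_; _≢_; refl; sym; trans; cong; cong₂; subst)
open import Relation.Nullary.Construct.Add.Supremum using (_⁺; ⊤⁺; [_])
open import Relation.Nullary.Decidable.Core using (does)
open import Relation.Nullary.Negation.Core using (¬_)

-- Real numbers: Cauchy sequences of rationals, two of which are equal
-- when their difference tends to 0.

IsCauchy : (ℕ → ℚ) → Set
IsCauchy s =
  ∀ ε → 0ℚ < ε → ∃[ N ] (∀ m n → N ≤ℕ m → N ≤ℕ n → ∣ s m -ℚ s n ∣ < ε)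

record ℝ : Set where
  constructor mkℝ
  field
    seq    : ℕ → ℚ
    cauchy : IsCauchy seq

open ℝ public

infix 4 _≃_ _≄_

_≃_ : Rel ℝ 0ℓ
x ≃ y = ∀ ε → 0ℚ < ε → ∃[ N ] (∀ n → N ≤ℕ n → ∣ seq x n -ℚ seq y n ∣ < ε)

_≄_ : Rel ℝ 0ℓ
x ≄ y = ¬ (x ≃ y)

fromℚ : ℚ → ℝ
fromℚ q = mkℝ (λ _ → q) λ ε 0<ε →
  0 , λ _ _ _ _ → subst (λ d → ∣ d ∣ < ε) (sym (ℚₚ.+-inverseʳ q)) 0<ε

0ℝ 1ℝ : ℝ
0ℝ = fromℚ 0ℚ
1ℝ = fromℚ 1ℚ

open +-*-Solver using (solve; _:=_; _:+_; _:*_; _:-_; :-_)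

half-pos : ∀ ε → 0ℚ < ε → 0ℚ < ½ *ℚ ε
half-pos ε 0<ε = subst (_< ½ *ℚ ε) (ℚₚ.*-zeroʳ ½) (ℚₚ.*-monoʳ-<-pos ½ 0<ε)

half+half : ∀ ε → ½ *ℚ ε +ℚ ½ *ℚ ε ≡ ε
half+half ε = trans (sym (ℚₚ.*-distribʳ-+ ε ½ ½)) (ℚₚ.*-identityˡ ε)

add-regroup : ∀ a b c d → (a +ℚ b) -ℚ (c +ℚ d) ≡ (a -ℚ c) +ℚ (b -ℚ d)
add-regroup = solve 4 (λ a b c d →
  (a :+ b) :- (c :+ d) := (a :- c) :+ (b :- d)) refl

mul-regroup : ∀ a b c d → a *ℚ b -ℚ c *ℚ d ≡ a *ℚ (b -ℚ d) +ℚ (a -ℚ c) *ℚ d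
mul-regroup = solve 4 (λ a b c d →
  a :* b :- c :* d := a :* (b :- d) :+ (a :- c) :* d) refl

neg-regroup : ∀ a b → (-ℚ a) -ℚ (-ℚ b) ≡ -ℚ (a -ℚ b)
neg-regroup = solve 2 (λ a b → (:- a) :- (:- b) := :- (a :- b)) refl

sub-add : ∀ a b → a ≡ (a -ℚ b) +ℚ b
sub-add = solve 2 (λ a b → a := (a :- b) :+ b) refl

-- The moduli are irrelevant to the value of a real; unfolding them would only
-- bloat terms, since they occur in every sum and product.
abstract
  +-cauchy : ∀ {s t} → IsCauchy s → IsCauchy t → IsCauchy (λ n → s n +ℚ t n)
  +-cauchy {s} {t} cs ct ε 0<ε
    with cs (½ *ℚ ε) (half-pos ε 0<ε) | ct (½ *ℚ ε) (half-pos ε 0<ε)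
  ... | N , p | M , q = N ⊔ M , λ m n h k → begin-strict
    ∣ (s m +ℚ t m) -ℚ (s n +ℚ t n) ∣     ≡⟨ cong ∣_∣ (add-regroup (s m) (t m) (s n) (t n)) ⟩
    ∣ (s m -ℚ s n) +ℚ (t m -ℚ t n) ∣     ≤⟨ ℚₚ.∣p+q∣≤∣p∣+∣q∣ (s m -ℚ s n) (t m -ℚ t n) ⟩
    ∣ s m -ℚ s n ∣ +ℚ ∣ t m -ℚ t n ∣     <⟨ ℚₚ.+-mono-<
                                              (p m n (ℕₚ.m⊔n≤o⇒m≤o N M h) (ℕₚ.m⊔n≤o⇒m≤o N M k))
                                              (q m n (ℕₚ.m⊔n≤o⇒n≤o N M h) (ℕₚ.m⊔n≤o⇒n≤o N M k)) ⟩
    ½ *ℚ ε +ℚ ½ *ℚ ε                     ≡⟨ half+half ε ⟩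
    ε                                    ∎
    where open ℚₚ.≤-Reasoning

abstract
  neg-cauchy : ∀ {s} → IsCauchy s → IsCauchy (λ n → -ℚ s n)
  neg-cauchy {s} cs ε 0<ε with cs ε 0<ε
  ... | N , p = N , λ m n h k → subst (_< ε)
    (sym (trans (cong ∣_∣ (neg-regroup (s m) (s n))) (ℚₚ.∣-p∣≡∣p∣ (s m -ℚ s n))))
    (p m n h k)

eventually-bounded : ∀ {s} → IsCauchy s →
  ∃[ K ] (0ℚ < K × ∃[ N ] (∀ m → N ≤ℕ m → ∣ s m ∣ ≤ K))
eventually-bounded {s} cs with cs 1ℚ (ℚₚ.positive⁻¹ 1ℚ)
... | N , p = 1ℚ +ℚ ∣ s N ∣ , 0<K , N , bound
  where
  open ℚₚ.≤-Reasoning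
  0<K : 0ℚ < 1ℚ +ℚ ∣ s N ∣
  0<K = ℚₚ.+-mono-<-≤ {0ℚ} {1ℚ} {0ℚ} (ℚₚ.positive⁻¹ 1ℚ) (ℚₚ.0≤∣p∣ (s N))
  bound : ∀ m → N ≤ℕ m → ∣ s m ∣ ≤ 1ℚ +ℚ ∣ s N ∣
  bound m h = begin
    ∣ s m ∣                      ≡⟨ cong ∣_∣ (sub-add (s m) (s N)) ⟩
    ∣ (s m -ℚ s N) +ℚ s N ∣      ≤⟨ ℚₚ.∣p+q∣≤∣p∣+∣q∣ (s m -ℚ s N) (s N) ⟩
    ∣ s m -ℚ s N ∣ +ℚ ∣ s N ∣    ≤⟨ ℚₚ.+-monoˡ-≤ ∣ s N ∣ (ℚₚ.<⇒≤ (p m N h ℕₚ.≤-refl)) ⟩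
    1ℚ +ℚ ∣ s N ∣                ∎

quotient : ∀ c ε → 0ℚ < c → 0ℚ < ε → ∃[ δ ] (0ℚ < δ × c *ℚ δ ≡ ε)
quotient c ε 0<c 0<ε = c⁻¹ *ℚ ε , 0<c⁻¹ε , c*c⁻¹ε≡ε
  where
  instance
    c-pos : Positive c
    c-pos = positive 0<c
    c-nonZero : NonZero c
    c-nonZero = ℚₚ.pos⇒nonZero c
  c⁻¹ : ℚ
  c⁻¹ = 1/ c
  0<c⁻¹ε : 0ℚ < c⁻¹ *ℚ ε
  0<c⁻¹ε = subst (_< c⁻¹ *ℚ ε) (ℚₚ.*-zeroʳ c⁻¹)
    (ℚₚ.*-monoʳ-<-pos c⁻¹ {{ℚₚ.1/pos⇒pos c}} 0<ε)
  c*c⁻¹ε≡ε : c *ℚ (c⁻¹ *ℚ ε) ≡ ε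
  c*c⁻¹ε≡ε = trans (sym (ℚₚ.*-assoc c c⁻¹ ε))
    (trans (cong (_*ℚ ε) (ℚₚ.*-inverseʳ c)) (ℚₚ.*-identityˡ ε))

product-bound : ∀ {K L δ} a b c d → 0ℚ < K → 0ℚ < L →
  ∣ a ∣ ≤ K → ∣ d ∣ ≤ L → ∣ b -ℚ d ∣ < δ → ∣ a -ℚ c ∣ < δ →
  ∣ a *ℚ b -ℚ c *ℚ d ∣ < K *ℚ δ +ℚ δ *ℚ L
product-bound {K} {L} {δ} a b c d 0<K 0<L a≤K d≤L b-d<δ a-c<δ = begin-strict
  ∣ a *ℚ b -ℚ c *ℚ d ∣
    ≡⟨ cong ∣_∣ (mul-regroup a b c d) ⟩
  ∣ a *ℚ (b -ℚ d) +ℚ (a -ℚ c) *ℚ d ∣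
    ≤⟨ ℚₚ.∣p+q∣≤∣p∣+∣q∣ (a *ℚ (b -ℚ d)) ((a -ℚ c) *ℚ d) ⟩
  ∣ a *ℚ (b -ℚ d) ∣ +ℚ ∣ (a -ℚ c) *ℚ d ∣
    ≡⟨ cong₂ _+ℚ_ (ℚₚ.∣p*q∣≡∣p∣*∣q∣ a (b -ℚ d)) (ℚₚ.∣p*q∣≡∣p∣*∣q∣ (a -ℚ c) d) ⟩
  ∣ a ∣ *ℚ ∣ b -ℚ d ∣ +ℚ ∣ a -ℚ c ∣ *ℚ ∣ d ∣
    ≤⟨ ℚₚ.+-mono-≤
         (ℚₚ.*-monoʳ-≤-nonNeg ∣ b -ℚ d ∣ {{ℚₚ.∣-∣-nonNeg (b -ℚ d)}} a≤K)
         (ℚₚ.*-monoˡ-≤-nonNeg ∣ a -ℚ c ∣ {{ℚₚ.∣-∣-nonNeg (a -ℚ c)}} d≤L) ⟩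
  K *ℚ ∣ b -ℚ d ∣ +ℚ ∣ a -ℚ c ∣ *ℚ L
    <⟨ ℚₚ.+-mono-<
         (ℚₚ.*-monoʳ-<-pos K {{positive 0<K}} b-d<δ)
         (ℚₚ.*-monoˡ-<-pos L {{positive 0<L}} a-c<δ) ⟩
  K *ℚ δ +ℚ δ *ℚ L
    ∎
  where open ℚₚ.≤-Reasoning

Kδ+δL : ∀ {K L δ ε} → (K +ℚ L) *ℚ δ ≡ ε → K *ℚ δ +ℚ δ *ℚ L ≡ ε
Kδ+δL {K} {L} {δ} eq = trans (cong (K *ℚ δ +ℚ_) (ℚₚ.*-comm δ L))
  (trans (sym (ℚₚ.*-distribʳ-+ δ K L)) eq)

product-close : ∀ {s t : ℕ → ℚ} {K L δ ε N₁ N₂ M₁ M₂} →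
  0ℚ < K → (∀ m → N₁ ≤ℕ m → ∣ s m ∣ ≤ K) →
  0ℚ < L → (∀ m → N₂ ≤ℕ m → ∣ t m ∣ ≤ L) →
  (∀ m n → M₁ ≤ℕ m → M₁ ≤ℕ n → ∣ s m -ℚ s n ∣ < δ) →
  (∀ m n → M₂ ≤ℕ m → M₂ ≤ℕ n → ∣ t m -ℚ t n ∣ < δ) →
  K *ℚ δ +ℚ δ *ℚ L ≡ ε →
  ∃[ N ] (∀ m n → N ≤ℕ m → N ≤ℕ n → ∣ s m *ℚ t m -ℚ s n *ℚ t n ∣ < ε)
product-close {s} {t} {K} {L} {δ} {ε} {N₁} {N₂} {M₁} {M₂} 0<K s≤K 0<L t≤L p q refl =
  (N₁ ⊔ M₁) ⊔ (N₂ ⊔ M₂) , λ m n h k →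
  let h₁ = ℕₚ.m⊔n≤o⇒m≤o (N₁ ⊔ M₁) (N₂ ⊔ M₂) h
      h₂ = ℕₚ.m⊔n≤o⇒n≤o (N₁ ⊔ M₁) (N₂ ⊔ M₂) h
      k₁ = ℕₚ.m⊔n≤o⇒m≤o (N₁ ⊔ M₁) (N₂ ⊔ M₂) k
      k₂ = ℕₚ.m⊔n≤o⇒n≤o (N₁ ⊔ M₁) (N₂ ⊔ M₂) k
  in product-bound {K} {L} {δ} (s m) (t m) (s n) (t n) 0<K 0<L
       (s≤K m (ℕₚ.m⊔n≤o⇒m≤o N₁ M₁ h₁))
       (t≤L n (ℕₚ.m⊔n≤o⇒m≤o N₂ M₂ k₂))
       (q m n (ℕₚ.m⊔n≤o⇒n≤o N₂ M₂ h₂) (ℕₚ.m⊔n≤o⇒n≤o N₂ M₂ k₂))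
       (p m n (ℕₚ.m⊔n≤o⇒n≤o N₁ M₁ h₁) (ℕₚ.m⊔n≤o⇒n≤o N₁ M₁ k₁))

abstract
  *-cauchy : ∀ {s t} → IsCauchy s → IsCauchy t → IsCauchy (λ n → s n *ℚ t n)
  *-cauchy {s} {t} cs ct ε 0<ε =
    let K , 0<K , N₁ , s≤K = eventually-bounded {s} cs
        L , 0<L , N₂ , t≤L = eventually-bounded {t} ct
        δ , 0<δ , eq = quotient (K +ℚ L) ε (ℚₚ.+-mono-< {0ℚ} {K} {0ℚ} {L} 0<K 0<L) 0<ε
        M₁ , p = cs δ 0<δ
        M₂ , q = ct δ 0<δ
    in product-close {s} {t} {K} {L} {δ} {ε} {N₁} {N₂} {M₁} {M₂}
         0<K s≤K 0<L t≤L p q (Kδ+δL {K} {L} {δ} {ε} eq)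

infix  8 -ℝ_
infixl 7 _*ℝ_
infixl 6 _+ℝ_

_+ℝ_ : ℝ → ℝ → ℝ
x +ℝ y = mkℝ (λ n → seq x n +ℚ seq y n) (+-cauchy {seq x} {seq y} (cauchy x) (cauchy y))

_*ℝ_ : ℝ → ℝ → ℝ
x *ℝ y = mkℝ (λ n → seq x n *ℚ seq y n) (*-cauchy {seq x} {seq y} (cauchy x) (cauchy y))

-ℝ_ : ℝ → ℝ
-ℝ x = mkℝ (λ n → -ℚ seq x n) (neg-cauchy {seq x} (cauchy x))

ℝ-rawRing : RawRing 0ℓ 0ℓ
ℝ-rawRing = record
  { Carrier = ℝ
  ; _≈_     = _≃_
  ; _+_     = _+ℝ_
  ; _*_     = _*ℝ_
  ; -_      = -ℝ_
  ; 0#      = 0ℝ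
  ; 1#      = 1ℝ
  }

Matrix : Set → ℕ → Set
Matrix A n = Vector (Vector A n) n

deleteAt : ∀ {A n} → Matrix A (suc n) → Fin (suc n) → Matrix A n
deleteAt A i j k = A (punchIn i j) (punchIn i k)

module _ (R : RawRing 0ℓ 0ℓ) where
  open RawRing R
  open RawSemiringDefs rawSemiring using (_^_)
  open RawMonoidDefs +-rawMonoid using (sum)

  -- Laplace expansion along the first row.
  det : ∀ {n} → Matrix Carrier n → Carrier
  det {zero}  A = 1#
  det {suc n} A = sum λ j →
    (- 1#) ^ toℕ j * A fzero j * det (λ i k → A (fsuc i) (punchIn j k))

module _ (R : RawRing 0ℓ 0ℓ) where
  open RawRing R

  -- a₀ ∷ a₁ ∷ … ∷ [] stands for a₀ + a₁ X + …; trailing zeros are allowed,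
  -- so polynomials are compared coefficientwise.
  Poly : Set
  Poly = List Carrier

  coeff : Poly → ℕ → Carrier
  coeff []      _       = 0#
  coeff (a ∷ p) zero    = a
  coeff (a ∷ p) (suc n) = coeff p n

  addPoly : Poly → Poly → Poly
  addPoly []      q       = q
  addPoly (a ∷ p) []      = a ∷ p
  addPoly (a ∷ p) (b ∷ q) = a + b ∷ addPoly p q

  mulPoly : Poly → Poly → Poly
  mulPoly []      q = []
  mulPoly (a ∷ p) q = addPoly (map (a *_) q) (0# ∷ mulPoly p q)

  polyRawRing : RawRing 0ℓ 0ℓ
  polyRawRing = record
    { Carrier = Poly
    ; _≈_     = λ p q → ∀ n → coeff p n ≈ coeff q n
    ; _+_     = addPoly
    ; _*_     = mulPoly
    ; -_      = map (-_)
    ; 0#      = []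
    ; 1#      = 1# ∷ []
    }

  X-_ : Carrier → Poly
  X- a = - a ∷ 1# ∷ []

  charPoly : ∀ {n} → Matrix Carrier n → Poly
  charPoly A = det polyRawRing λ i j →
    if does (i ≟ᶠ j) then X- A i j else - A i j ∷ []

-- m_A(λ) = k, as a relation: the multiplicity is not computable from
-- Cauchy representatives.
HasMultiplicity : ∀ {n} → Matrix ℝ n → ℝ → ℕ → Set
HasMultiplicity A r k =
  (X-_ ℝ-rawRing r) ^ k ∣ charPoly ℝ-rawRing A ×
  (X-_ ℝ-rawRing r) ^ suc k ∤ charPoly ℝ-rawRing A
  where
  open RawSemiringDefs (RawRing.rawSemiring (polyRawRing ℝ-rawRing))
    using (_^_; _∣_; _∤_)

NonSingular : ∀ {n} → Matrix ℝ n → Set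
NonSingular A = det ℝ-rawRing A ≄ 0ℝ

record Graph (n : ℕ) : Set₁ where
  infix 4 _~_
  field
    _~_    : Rel (Fin n) 0ℓ
    ~-sym  : Symmetric _~_
    ~-irr  : Irreflexive _≡_ _~_
    _~?_   : Decidable _~_

record PerfectMatching {n} (G : Graph n) : Set₁ where
  open Graph G
  field
    _M_     : Rel (Fin n) 0ℓ
    M-sym   : Symmetric _M_
    M⊆E     : ∀ {i j} → i M j → i ~ j
    covered : ∀ i → ∃! _≡_ (i M_)

Support : ∀ {n} → Matrix ℝ n → Rel (Fin n) 0ℓ
Support A i j = i ≢ j × A i j ≄ 0ℝ

infix 4 _∈S_

record _∈S_ {n} (A : Matrix ℝ n) (G : Graph n) : Set where
  open Graph G
  field
    symmetric : ∀ i j → A i j ≃ A j i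
    support   : ∀ i j → Support A i j ⇔ i ~ j

IsPVertex : ∀ {n} → Matrix ℝ (suc n) → Fin (suc n) → Set
IsPVertex A i =
  ∃[ k ] (HasMultiplicity A 0ℝ k × HasMultiplicity (deleteAt A i) 0ℝ (suc k))

record IsPCover {n k} (G : Graph (suc n)) (𝒜 : Vector (Matrix ℝ (suc n)) k) : Set where
  field
    distinct    : ∀ a b → (∀ i j → 𝒜 a i j ≃ 𝒜 b i j) → a ≡ b
    inS         : ∀ a → 𝒜 a ∈S G
    nonSingular : ∀ a → NonSingular (𝒜 a)
    covers      : ∀ i → ∃[ a ] IsPVertex (𝒜 a) i

HasPCover : ∀ {n} → Graph (suc n) → ℕ → Set
HasPCover {n} G k = ∃ λ (𝒜 : Vector (Matrix ℝ (suc n)) k) → IsPCover G 𝒜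

-- p(G) = κ for κ ∈ ℕ ∪ {∞}.  Every covering family contains a finite one, as
-- there are finitely many vertices, so finite families suffice also for κ = ∞.
p[_]≡_ : ∀ {n} → Graph (suc n) → ℕ ⁺ → Set
p[ G ]≡ [ k ] = HasPCover G k × (∀ l → HasPCover G l → k ≤ℕ l)
p[ G ]≡ ⊤⁺    = ∀ k → ¬ HasPCover G k

{-# OPTIONS --safe #-}
module Submission where

-- Let μ be the matching involution and let -A have the entries 1 at the matching edges, η at the other
-- edges, and η c i on the diagonal, where η is small.  For η = 0 the minor det (-A(i)) vanishes, since
-- the row of μ i in A(i) is zero; to first order in η it is ± η c (μ i), because the rest of A(i) is
-- perfectly matched.  So c ↦ det (-A(i)) / η is a small perturbation of a signed permutation of the
-- coordinates, and the modified Newton iteration contracts to a real c for which all these minors vanish.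
-- The same first order estimate, applied to -A(i) + x I, shows that the coefficient of X in the
-- characteristic polynomial of A(i) is nonzero, so 0 is a simple root, while det A is near ± 1.

open import Defs
open import Algebra.Bundles using (CommutativeRing; CommutativeMonoid)
open import Algebra.Bundles.Raw using (RawRing)
import Algebra.Definitions.RawSemiring as RawSemiringDefs
import Algebra.Properties.CommutativeMonoid.Sum as CMSum
import Algebra.Properties.Ring as RingProps
open import Data.Bool.Base using (if_then_else_)
open import Data.Fin.Base using (Fin; toℕ; punchIn; punchOut) renaming (zero to fzero; suc to fsuc)
open import Data.Fin.Permutation
  using (Permutation′; permutation; _⟨$⟩ʳ_; _⟨$⟩ˡ_; remove; inverseʳ; punchIn-permute)
open import Data.Fin.Properties using (punchInᵢ≢i; punchIn-injective; punchIn-punchOut) renaming (_≟_ to _≟ᶠ_)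
import Data.Integer.Base as ℤ
import Data.Integer.Properties as ℤₚ
open import Data.List.Base using ([]; _∷_; map; drop)
open import Data.Nat.Base using (ℕ; zero; suc; z≤n; s≤s; _∸_) renaming (_≤_ to _≤ℕ_; _+_ to _+ℕ_; _*_ to _*ℕ_)
import Data.Nat.Properties as ℕₚ
open import Data.Product.Base using (_×_; _,_; proj₁; proj₂; ∃-syntax)
open import Data.Rational.Base
  using (ℚ; mkℚ; 0ℚ; 1ℚ; ½; _<_; _≤_; ∣_∣; Positive; positive; nonNegative; toℚᵘ)
  renaming (_+_ to _+ℚ_; _*_ to _*ℚ_; _-_ to _-ℚ_; -_ to -ℚ_)
import Data.Rational.Properties as ℚₚ
open import Data.Rational.Solver using (module +-*-Solver)
import Data.Rational.Unnormalised.Base as ℚᵘ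
import Data.Rational.Unnormalised.Properties as ℚᵘₚ
open import Data.Vec.Functional using (Vector)
open import Function.Base using (_∘_)
open import Function.Bundles using (mk⇔)
open import Level using (0ℓ)
open import Relation.Binary.PropositionalEquality
  using (_≡_; _≢_; refl; sym; trans; cong; cong₂; subst; subst₂; isEquivalence; module ≡-Reasoning)
open import Relation.Nullary using (¬_; Dec; does; yes; no; contradiction)
open import Relation.Nullary.Decidable using (decidable-stable; toWitness)
open import Relation.Nullary.Construct.Add.Supremum using ([_])

open +-*-Solver using (solve; _:=_; _:+_; _:*_; _:-_; :-_; con)

-- Determinants

-- Equality of Cauchy reals is undecidable, so all estimates are made over ℚ, uniformly along the
-- iteration. Real operations act termwise: the k-th terms of `A` form `-B` at the k-th rational
-- iterate, and those of determinants and characteristic coefficients follow by homomorphism. A real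
-- minor vanishes because its rational terms tend to 0; nonvanishing comes from lower bounds
-- independent of k. The contraction is proved without calculus. A minor is a polynomial in c, so
-- its evaluation at c + x e in ℚ[x]/(x² - t x) carries its value at c and its exact difference
-- quotient with step t. One perturbation estimate over a normed ring bounds both, and t = 0 gives
-- the derivative along I that controls the multiplicity. In A(i) the row of μ i has lost its
-- matching entry, so all its entries are of order η. With the rows bounded separately, the monomial
-- approximation has relative error n · 2η on a scale n! · 2η, that is 4 n n! η², at most half of
-- the leading order η once 8 n n! η ≤ 1. This half is both the contraction rate and the margin that
-- keeps the derivative away from 0.

module _ (R : RawRing 0ℓ 0ℓ) where
  open RawRing R
  open RawSemiringDefs rawSemiring using (_^_)

  -- The sign in the form that expansion along first rows produces: `π 0` counts the inversions in
  -- which row 0 takes part.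
  sgn : ∀ {n} → Permutation′ n → Carrier
  sgn {zero}  π = 1#
  sgn {suc n} π = (- 1#) ^ toℕ (π ⟨$⟩ʳ fzero) * sgn (remove fzero π)

-- Operations are preserved up to `≡`, with no compatibility with `≈` asked for: taking the k-th
-- term of a Cauchy sequence does not respect `≃`, yet it commutes with every operation and hence
-- with `det`.
record StrictHom (R S : RawRing 0ℓ 0ℓ) : Set where
  private
    module R = RawRing R
    module S = RawRing S
  field
    ⟦_⟧    : R.Carrier → S.Carrier
    +-hom  : ∀ x y → ⟦ x R.+ y ⟧ ≡ ⟦ x ⟧ S.+ ⟦ y ⟧
    *-hom  : ∀ x y → ⟦ x R.* y ⟧ ≡ ⟦ x ⟧ S.* ⟦ y ⟧
    neg-hom : ∀ x → ⟦ R.- x ⟧ ≡ S.- ⟦ x ⟧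
    0#-hom : ⟦ R.0# ⟧ ≡ S.0#
    1#-hom : ⟦ R.1# ⟧ ≡ S.1#

  private
    module R^ = RawSemiringDefs R.rawSemiring
    module S^ = RawSemiringDefs S.rawSemiring

  sign-hom : ∀ n → ⟦ (R.- R.1#) R^.^ n ⟧ ≡ (S.- S.1#) S^.^ n
  sign-hom zero    = 1#-hom
  sign-hom (suc n) = trans (*-hom _ _)
    (cong₂ S._*_ (trans (neg-hom _) (cong (S.-_) 1#-hom)) (sign-hom n))

  sum-hom : ∀ {n} {f : Vector R.Carrier n} {g : Vector S.Carrier n} →
    (∀ i → ⟦ f i ⟧ ≡ g i) → ⟦ R^.sum f ⟧ ≡ S^.sum g
  sum-hom {zero}  eq = 0#-hom
  sum-hom {suc n} eq = trans (+-hom _ _) (cong₂ S._+_ (eq fzero) (sum-hom (eq ∘ fsuc)))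

  det-hom : ∀ {n} {A : Matrix R.Carrier n} {B : Matrix S.Carrier n} →
    (∀ i j → ⟦ A i j ⟧ ≡ B i j) → ⟦ det R A ⟧ ≡ det S B
  det-hom {zero}  eq = 1#-hom
  det-hom {suc n} eq = sum-hom λ j → trans (*-hom _ _) (cong₂ S._*_
    (trans (*-hom _ _) (cong₂ S._*_ (sign-hom (toℕ j)) (eq fzero j)))
    (det-hom λ i k → eq (fsuc i) (punchIn j k)))

  sgn-hom : ∀ {n} (π : Permutation′ n) → ⟦ sgn R π ⟧ ≡ sgn S π
  sgn-hom {zero}  π = 1#-hom
  sgn-hom {suc n} π = trans (*-hom _ _)
    (cong₂ S._*_ (sign-hom (toℕ (π ⟨$⟩ʳ fzero))) (sgn-hom (remove fzero π)))

module _ (M : CommutativeMonoid 0ℓ 0ℓ) where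
  open CommutativeMonoid M
    renaming (refl to ≈-refl; sym to ≈-sym; trans to ≈-trans)
  open CMSum M using (sum; sum-remove; sum-cong-≋; sum-replicate-zero)

  -- Stated for a commutative monoid because it serves sums, where `ε` is 0, as well as products,
  -- where `ε` is 1.
  sum-single : ∀ {n} (t : Vector Carrier n) i → (∀ j → j ≢ i → t j ≈ ε) → sum t ≈ t i
  sum-single {suc n} t i z = ≈-trans (sum-remove {i = i} t)
    (≈-trans (∙-congˡ (≈-trans (sum-cong-≋ λ j → z (punchIn i j) (punchInᵢ≢i i j))
                               (sum-replicate-zero n)))
             (identityʳ (t i)))

  sum-zero : ∀ {n} (t : Vector Carrier n) → (∀ j → t j ≈ ε) → sum t ≈ ε
  sum-zero {n} t z = ≈-trans (sum-cong-≋ z) (sum-replicate-zero n)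

module DetProperties (R : CommutativeRing 0ℓ 0ℓ) where
  open CommutativeRing R
    renaming (refl to ≈-refl; sym to ≈-sym; trans to ≈-trans)
  open RawSemiringDefs (RawRing.rawSemiring rawRing) using (_^_; product)
  open RingProps ring using (-‿involutive; -1*x≈-x)
  open import Relation.Binary.Reasoning.Setoid setoid

  minor₀ : ∀ {n} → Matrix Carrier (suc n) → Fin (suc n) → Matrix Carrier n
  minor₀ A j i k = A (fsuc i) (punchIn j k)

  laplaceTerm : ∀ {n} → Matrix Carrier (suc n) → Fin (suc n) → Carrier
  laplaceTerm A j = (- 1#) ^ toℕ j * A fzero j * det rawRing (minor₀ A j)

  laplaceTerm-zeroˡ : ∀ {n} (A : Matrix Carrier (suc n)) j → A fzero j ≈ 0# → laplaceTerm A j ≈ 0#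
  laplaceTerm-zeroˡ A j z =
    ≈-trans (*-congʳ (≈-trans (*-congˡ z) (zeroʳ ((- 1#) ^ toℕ j)))) (zeroˡ (det rawRing (minor₀ A j)))

  laplaceTerm-zeroʳ : ∀ {n} (A : Matrix Carrier (suc n)) j →
    det rawRing (minor₀ A j) ≈ 0# → laplaceTerm A j ≈ 0#
  laplaceTerm-zeroʳ A j z = ≈-trans (*-congˡ z) (zeroʳ ((- 1#) ^ toℕ j * A fzero j))

  det-zero-row : ∀ {n} (A : Matrix Carrier n) r → (∀ c → A r c ≈ 0#) → det rawRing A ≈ 0#
  det-zero-row A fzero    z = sum-zero +-commutativeMonoid (laplaceTerm A) λ j →
    laplaceTerm-zeroˡ A j (z j)
  det-zero-row A (fsuc r) z = sum-zero +-commutativeMonoid (laplaceTerm A) λ j →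
    laplaceTerm-zeroʳ A j (det-zero-row (minor₀ A j) r λ c → z (punchIn j c))

  -- The exceptional row r is a natural number, so that r ≥ n means that there is none.
  det-monomial : ∀ {n} (π : Permutation′ n) (r : ℕ) (Q : Matrix Carrier n) →
    (∀ k c → toℕ k ≢ r → c ≢ π ⟨$⟩ʳ k → Q k c ≈ 0#) →
    det rawRing Q ≈ sgn rawRing π * product (λ k → Q k (π ⟨$⟩ʳ k))
  det-monomial {zero}  π r Q z = ≈-sym (*-identityʳ _)
  det-monomial {suc n} π r Q z = begin
    det rawRing Q
      ≈⟨ sum-single +-commutativeMonoid (laplaceTerm Q) j₀ (others r z) ⟩
    s * Q fzero j₀ * det rawRing (minor j₀)
      ≈⟨ *-congˡ (det-monomial π′ (r′ r) (minor j₀) (below r z)) ⟩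
    s * Q fzero j₀ * (sgn rawRing π′ * product (λ k → minor j₀ k (π′ ⟨$⟩ʳ k)))
      ≈⟨ *-interchange s _ _ _ ⟩
    s * sgn rawRing π′ * (Q fzero j₀ * product (λ k → minor j₀ k (π′ ⟨$⟩ʳ k)))
      ≈⟨ *-congˡ (*-congˡ (product-cong λ k →
           reflexive (cong (Q (fsuc k)) (sym (punchIn-permute π fzero k))))) ⟩
    s * sgn rawRing π′ * (Q fzero j₀ * product (λ k → Q (fsuc k) (π ⟨$⟩ʳ fsuc k)))
      ∎
    where
    j₀ = π ⟨$⟩ʳ fzero
    π′ = remove fzero π
    s  = (- 1#) ^ toℕ j₀
    minor = minor₀ Q
    r′ : ℕ → ℕ
    -- Once the exceptional row has been expanded, `n` is out of range for the minor, so all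
    -- remaining rows are monomial.
    r′ zero    = n
    r′ (suc r) = r
    *-interchange : ∀ a b c d → a * b * (c * d) ≈ a * c * (b * d)
    *-interchange = CommSemigroupProps.interchange
      where
      import Algebra.Properties.CommutativeSemigroup *-commutativeSemigroup as CommSemigroupProps
    product-cong : ∀ {m} {f g : Vector Carrier m} → (∀ i → f i ≈ g i) → product f ≈ product g
    product-cong = CMSum.sum-cong-≋ *-commutativeMonoid
    below : ∀ r → (∀ k c → toℕ k ≢ r → c ≢ π ⟨$⟩ʳ k → Q k c ≈ 0#) →
      ∀ k c → toℕ k ≢ r′ r → c ≢ π′ ⟨$⟩ʳ k → minor j₀ k c ≈ 0#
    below r z k c k≢r c≢ = z (fsuc k) (punchIn j₀ c) (k≢ r k≢r)
      λ eq → c≢ (punchIn-injective j₀ c _ (trans eq (punchIn-permute π fzero k)))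
      where
      k≢ : ∀ r → toℕ k ≢ r′ r → suc (toℕ k) ≢ r
      k≢ (suc r) k≢r eq = k≢r (ℕₚ.suc-injective eq)
    others : ∀ r → (∀ k c → toℕ k ≢ r → c ≢ π ⟨$⟩ʳ k → Q k c ≈ 0#) →
      ∀ j → j ≢ j₀ → laplaceTerm Q j ≈ 0#
    others (suc r) z j j≢j₀ =
      laplaceTerm-zeroˡ Q j (z fzero j (λ ()) j≢j₀)
    -- Row 0 is arbitrary here, so its entry at `j` may be nonzero. But the row that `π` sends to
    -- `j` has its only possibly nonzero entry in the deleted column, so the minor has a zero row.
    others zero    z j j≢j₀ with π ⟨$⟩ˡ j in eq
    ... | fzero  = contradiction (trans (sym (inverseʳ π)) (cong (π ⟨$⟩ʳ_) eq)) j≢j₀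
    ... | fsuc k = laplaceTerm-zeroʳ Q j (det-zero-row (minor j) k λ c →
      z (fsuc k) (punchIn j c) (λ ()) λ e → punchInᵢ≢i j c
        (trans e (trans (cong (π ⟨$⟩ʳ_) (sym eq)) (inverseʳ π))))

  sign*sign≈1 : ∀ n → (- 1#) ^ n * (- 1#) ^ n ≈ 1#
  sign*sign≈1 zero    = *-identityˡ 1#
  sign*sign≈1 (suc n) = begin
    - 1# * u * (- 1# * u)     ≈⟨ interchange _ _ _ _ ⟩
    - 1# * - 1# * (u * u)     ≈⟨ *-cong (≈-trans (-1*x≈-x (- 1#)) (-‿involutive 1#)) (sign*sign≈1 n) ⟩
    1# * 1#                   ≈⟨ *-identityˡ 1# ⟩
    1#                        ∎
    where
    u = (- 1#) ^ n
    open import Algebra.Properties.CommutativeSemigroup *-commutativeSemigroup using (interchange)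

  sgn*sgn≈1 : ∀ {n} (π : Permutation′ n) → sgn rawRing π * sgn rawRing π ≈ 1#
  sgn*sgn≈1 {zero}  π = *-identityˡ 1#
  sgn*sgn≈1 {suc n} π = ≈-trans (interchange _ _ _ _)
    (≈-trans (*-cong (sign*sign≈1 (toℕ (π ⟨$⟩ʳ fzero))) (sgn*sgn≈1 (remove fzero π))) (*-identityˡ 1#))
    where open import Algebra.Properties.CommutativeSemigroup *-commutativeSemigroup using (interchange)

-- Determinants close to those of monomial matrices

ℚ-commutativeRing : CommutativeRing 0ℓ 0ℓ
ℚ-commutativeRing = ℚₚ.+-*-commutativeRing

ℚ-rawRing : RawRing 0ℓ 0ℓ
ℚ-rawRing = CommutativeRing.rawRing ℚ-commutativeRing

open RawSemiringDefs (RawRing.rawSemiring ℚ-rawRing) using () renaming (product to productℚ)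

*-mono-≤ℚ : ∀ {p q r s} → 0ℚ ≤ p → 0ℚ ≤ s → p ≤ q → r ≤ s → p *ℚ r ≤ q *ℚ s
*-mono-≤ℚ {p} {q} {r} {s} 0≤p 0≤s p≤q r≤s = ℚₚ.≤-trans
  (ℚₚ.*-monoˡ-≤-nonNeg p {{nonNegative 0≤p}} r≤s)
  (ℚₚ.*-monoʳ-≤-nonNeg s {{nonNegative 0≤s}} p≤q)

*-nonNegℚ : ∀ {p q} → 0ℚ ≤ p → 0ℚ ≤ q → 0ℚ ≤ p *ℚ q
*-nonNegℚ {p} {q} 0≤p 0≤q = subst (_≤ p *ℚ q) (ℚₚ.*-zeroˡ q)
  (ℚₚ.*-monoʳ-≤-nonNeg q {{nonNegative 0≤q}} 0≤p)

+-nonNegℚ : ∀ {p q} → 0ℚ ≤ p → 0ℚ ≤ q → 0ℚ ≤ p +ℚ q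
+-nonNegℚ {p} {q} 0≤p 0≤q = ℚₚ.+-mono-≤ {0ℚ} {p} {0ℚ} {q} 0≤p 0≤q

0≤1 : 0ℚ ≤ 1ℚ
0≤1 = ℚₚ.nonNegative⁻¹ 1ℚ

fromℕ : ℕ → ℚ
fromℕ zero    = 0ℚ
fromℕ (suc n) = 1ℚ +ℚ fromℕ n

0≤fromℕ : ∀ n → 0ℚ ≤ fromℕ n
0≤fromℕ zero    = ℚₚ.≤-refl
0≤fromℕ (suc n) = +-nonNegℚ 0≤1 (0≤fromℕ n)

factorial : ℕ → ℚ
factorial zero    = 1ℚ
factorial (suc n) = fromℕ (suc n) *ℚ factorial n

0≤factorial : ∀ n → 0ℚ ≤ factorial n
0≤factorial zero    = 0≤1
0≤factorial (suc n) = *-nonNegℚ (0≤fromℕ (suc n)) (0≤factorial n)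

-- Common ground of ℚ and the difference rings below, so that a single perturbation estimate covers
-- determinants, their difference quotients and their derivatives.
record SubmultiplicativeNorm (R : CommutativeRing 0ℓ 0ℓ) : Set where
  open CommutativeRing R
  field
    ∥_∥       : Carrier → ℚ
    ∥∥-cong   : ∀ {x y} → x ≈ y → ∥ x ∥ ≡ ∥ y ∥
    0≤∥∥      : ∀ x → 0ℚ ≤ ∥ x ∥
    ∥0∥≤0     : ∥ 0# ∥ ≤ 0ℚ
    ∥1∥≤1     : ∥ 1# ∥ ≤ 1ℚ
    ∥-1∥≤1    : ∥ - 1# ∥ ≤ 1ℚ
    ∥x+y∥≤    : ∀ x y → ∥ x + y ∥ ≤ ∥ x ∥ +ℚ ∥ y ∥
    ∥x*y∥≤    : ∀ x y → ∥ x * y ∥ ≤ ∥ x ∥ *ℚ ∥ y ∥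

module Perturbation {R : CommutativeRing 0ℓ 0ℓ} (norm : SubmultiplicativeNorm R) where
  open CommutativeRing R hiding (_-_) renaming (refl to ≈-refl; sym to ≈-sym; trans to ≈-trans)
  open SubmultiplicativeNorm norm
  open RawSemiringDefs (RawRing.rawSemiring rawRing) using (_^_; product) renaming (sum to sumR)
  open RingProps ring using (-‿+-comm; -‿distribˡ-*; -‿distribʳ-*)
  open import Algebra.Properties.CommutativeSemigroup +-commutativeSemigroup using (interchange)

  private
    infixl 6 _-_
    _-_ : Carrier → Carrier → Carrier
    x - y = x + - y

  -- A relative error: the scale b multiplies, while the error κ adds up, under multiplication.
  record Close (b κ : ℚ) (x y : Carrier) : Set where
    constructor mkClose
    field
      boundˡ : ∥ x ∥ ≤ b
      boundʳ : ∥ y ∥ ≤ b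
      error  : ∥ x - y ∥ ≤ κ *ℚ b

  x-x≤0 : ∀ x {p} → 0ℚ ≤ p → ∥ x - x ∥ ≤ p
  x-x≤0 x 0≤p = ℚₚ.≤-trans (ℚₚ.≤-reflexive (∥∥-cong (-‿inverseʳ x))) (ℚₚ.≤-trans ∥0∥≤0 0≤p)

  close-refl : ∀ {b κ x} → 0ℚ ≤ κ → ∥ x ∥ ≤ b → Close b κ x x
  close-refl {x = x} 0≤κ x≤b =
    mkClose x≤b x≤b (x-x≤0 x (*-nonNegℚ 0≤κ (ℚₚ.≤-trans (0≤∥∥ x) x≤b)))

  close-+ : ∀ {b b′ κ x x′ y y′} → Close b κ x y → Close b′ κ x′ y′ →
    Close (b +ℚ b′) κ (x + x′) (y + y′)
  close-+ {b} {b′} {κ} {x} {x′} {y} {y′} (mkClose p q d) (mkClose p′ q′ d′) = mkClose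
    (ℚₚ.≤-trans (∥x+y∥≤ x x′) (ℚₚ.+-mono-≤ p p′))
    (ℚₚ.≤-trans (∥x+y∥≤ y y′) (ℚₚ.+-mono-≤ q q′))
    (begin
      ∥ (x + x′) - (y + y′) ∥            ≡⟨ ∥∥-cong (≈-trans (+-congˡ (≈-sym (-‿+-comm y y′))) (interchange x x′ (- y) (- y′))) ⟩
      ∥ (x - y) + (x′ - y′) ∥            ≤⟨ ∥x+y∥≤ (x - y) (x′ - y′) ⟩
      ∥ x - y ∥ +ℚ ∥ x′ - y′ ∥           ≤⟨ ℚₚ.+-mono-≤ d d′ ⟩
      κ *ℚ b +ℚ κ *ℚ b′                  ≡⟨ ℚₚ.*-distribˡ-+ κ b b′ ⟨
      κ *ℚ (b +ℚ b′)                     ∎)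
    where open ℚₚ.≤-Reasoning

  *-regroup : ∀ x x′ y y′ → x * x′ - y * y′ ≈ x * (x′ - y′) + (x - y) * y′
  *-regroup x x′ y y′ = ≈-sym (begin
    x * (x′ - y′) + (x - y) * y′                        ≈⟨ +-cong (distribˡ x x′ (- y′)) (distribʳ y′ x (- y)) ⟩
    (x * x′ + x * - y′) + (x * y′ + - y * y′)           ≈⟨ +-assoc (x * x′) (x * - y′) (x * y′ + - y * y′) ⟩
    x * x′ + (x * - y′ + (x * y′ + - y * y′))           ≈⟨ +-congˡ (≈-sym (+-assoc (x * - y′) (x * y′) (- y * y′))) ⟩
    x * x′ + ((x * - y′ + x * y′) + - y * y′)           ≈⟨ +-congˡ (+-cong cancel (≈-sym (-‿distribˡ-* y y′))) ⟩
    x * x′ + (0# + - (y * y′))                          ≈⟨ +-congˡ (+-identityˡ (- (y * y′))) ⟩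
    x * x′ - y * y′                                     ∎)
    where
    open import Relation.Binary.Reasoning.Setoid setoid
    cancel : x * - y′ + x * y′ ≈ 0#
    cancel = ≈-trans (≈-sym (distribˡ x (- y′) y′)) (≈-trans (*-congˡ (-‿inverseˡ y′)) (zeroʳ x))

  close-* : ∀ {b b′ κ κ′ x x′ y y′} → Close b κ x y → Close b′ κ′ x′ y′ →
    Close (b *ℚ b′) (κ +ℚ κ′) (x * x′) (y * y′)
  close-* {b} {b′} {κ} {κ′} {x} {x′} {y} {y′} (mkClose p q d) (mkClose p′ q′ d′) = mkClose
    (ℚₚ.≤-trans (∥x*y∥≤ x x′) (*-mono-≤ℚ (0≤∥∥ x) 0≤b′ p p′))
    (ℚₚ.≤-trans (∥x*y∥≤ y y′) (*-mono-≤ℚ (0≤∥∥ y) 0≤b′ q q′))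
    (begin
      ∥ x * x′ - y * y′ ∥                             ≡⟨ ∥∥-cong (*-regroup x x′ y y′) ⟩
      ∥ x * (x′ - y′) + (x - y) * y′ ∥                ≤⟨ ∥x+y∥≤ (x * (x′ - y′)) ((x - y) * y′) ⟩
      ∥ x * (x′ - y′) ∥ +ℚ ∥ (x - y) * y′ ∥           ≤⟨ ℚₚ.+-mono-≤ (∥x*y∥≤ x (x′ - y′)) (∥x*y∥≤ (x - y) y′) ⟩
      ∥ x ∥ *ℚ ∥ x′ - y′ ∥ +ℚ ∥ x - y ∥ *ℚ ∥ y′ ∥     ≤⟨ ℚₚ.+-mono-≤
                                                          (*-mono-≤ℚ (0≤∥∥ x) (ℚₚ.≤-trans (0≤∥∥ (x′ - y′)) d′) p d′)
                                                          (*-mono-≤ℚ (0≤∥∥ (x - y)) 0≤b′ d q′) ⟩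
      b *ℚ (κ′ *ℚ b′) +ℚ (κ *ℚ b) *ℚ b′               ≡⟨ regroup b b′ κ κ′ ⟩
      (κ +ℚ κ′) *ℚ (b *ℚ b′)                          ∎)
    where
    open ℚₚ.≤-Reasoning
    0≤b′ : 0ℚ ≤ b′
    0≤b′ = ℚₚ.≤-trans (0≤∥∥ x′) p′
    regroup : ∀ b b′ κ κ′ → b *ℚ (κ′ *ℚ b′) +ℚ (κ *ℚ b) *ℚ b′ ≡ (κ +ℚ κ′) *ℚ (b *ℚ b′)
    regroup = solve 4 (λ b b′ κ κ′ → b :* (κ′ :* b′) :+ (κ :* b) :* b′ := (κ :+ κ′) :* (b :* b′)) refl

  ∥sign∥≤1 : ∀ n → ∥ (- 1#) ^ n ∥ ≤ 1ℚ
  ∥sign∥≤1 zero    = ∥1∥≤1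
  ∥sign∥≤1 (suc n) = ℚₚ.≤-trans (∥x*y∥≤ (- 1#) ((- 1#) ^ n))
    (*-mono-≤ℚ {q = 1ℚ} (0≤∥∥ (- 1#)) 0≤1 ∥-1∥≤1 (∥sign∥≤1 n))

  ∥sgn∥≤1 : ∀ {n} (π : Permutation′ n) → ∥ sgn rawRing π ∥ ≤ 1ℚ
  ∥sgn∥≤1 {zero}  π = ∥1∥≤1
  ∥sgn∥≤1 {suc n} π = ℚₚ.≤-trans (∥x*y∥≤ _ (sgn rawRing (remove fzero π)))
    (*-mono-≤ℚ {q = 1ℚ} (0≤∥∥ _) 0≤1 (∥sign∥≤1 (toℕ (π ⟨$⟩ʳ fzero))) (∥sgn∥≤1 (remove fzero π)))

  close-sum : ∀ {n b κ} → 0ℚ ≤ κ → {f g : Vector Carrier n} → (∀ i → Close b κ (f i) (g i)) →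
    Close (fromℕ n *ℚ b) κ (sumR f) (sumR g)
  close-sum {zero}  {b} {κ} 0≤κ c = subst (λ z → Close z κ 0# 0#) (sym (ℚₚ.*-zeroˡ b)) (close-refl 0≤κ ∥0∥≤0)
  close-sum {suc n} {b} {κ} 0≤κ {f} {g} c =
    subst (λ z → Close z κ (sumR f) (sumR g)) (regroup b (fromℕ n)) (close-+ (c fzero) (close-sum 0≤κ (c ∘ fsuc)))
    where
    regroup : ∀ b m → b +ℚ m *ℚ b ≡ (1ℚ +ℚ m) *ℚ b
    regroup = solve 2 (λ b m → b :+ m :* b := (con 1ℚ :+ m) :* b) refl

  -- Each of the n! terms of the expansion takes one entry from every row: the row scales multiply
  -- to the product of `b`, and the n relative errors `δ` add up. Separate scales per row let one
  -- small row shrink the whole bound.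
  det-close : ∀ {n δ} → 0ℚ ≤ δ → (b : Vector ℚ n) {P Q : Matrix Carrier n} →
    (∀ k c → Close (b k) δ (P k c) (Q k c)) →
    Close (factorial n *ℚ productℚ b) (fromℕ n *ℚ δ) (det rawRing P) (det rawRing Q)
  det-close {zero}  {δ} 0≤δ b c = close-refl (*-nonNegℚ ℚₚ.≤-refl 0≤δ) ∥1∥≤1
  det-close {suc n} {δ} 0≤δ b {P} {Q} c =
    subst₂ (λ z κ → Close z κ (det rawRing P) (det rawRing Q))
      (regroup (fromℕ n) (b fzero) (factorial n) (productℚ (b ∘ fsuc)))
      (regroup′ δ (fromℕ n))
      (close-sum (+-nonNegℚ (+-nonNegℚ (ℚₚ.≤-refl {0ℚ}) 0≤δ) (*-nonNegℚ (0≤fromℕ n) 0≤δ)) λ j →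
        close-* (close-* (close-refl ℚₚ.≤-refl (∥sign∥≤1 (toℕ j))) (c fzero j))
                (det-close 0≤δ (b ∘ fsuc) λ k l → c (fsuc k) (punchIn j l)))
    where
    regroup : ∀ m b f p → (1ℚ +ℚ m) *ℚ (1ℚ *ℚ b *ℚ (f *ℚ p)) ≡ ((1ℚ +ℚ m) *ℚ f) *ℚ (b *ℚ p)
    regroup = solve 4 (λ m b f p →
      (con 1ℚ :+ m) :* (con 1ℚ :* b :* (f :* p)) := ((con 1ℚ :+ m) :* f) :* (b :* p)) refl
    regroup′ : ∀ δ m → (0ℚ +ℚ δ) +ℚ m *ℚ δ ≡ (1ℚ +ℚ m) *ℚ δ
    regroup′ = solve 2 (λ δ m → (con 0ℚ :+ δ) :+ m :* δ := (con 1ℚ :+ m) :* δ) refl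

  -- Compare P with the matrix obtained by clearing the entries off π outside row r.
  det-near-monomial : ∀ {n δ} → 0ℚ ≤ δ → (b : Vector ℚ n) (π : Permutation′ n) (r : ℕ) (P : Matrix Carrier n) →
    (∀ k c → ∥ P k c ∥ ≤ b k) →
    (∀ k c → toℕ k ≢ r → c ≢ π ⟨$⟩ʳ k → ∥ P k c ∥ ≤ δ *ℚ b k) →
    ∥ det rawRing P - sgn rawRing π * product (λ k → P k (π ⟨$⟩ʳ k)) ∥
      ≤ (fromℕ n *ℚ δ) *ℚ (factorial n *ℚ productℚ b)
  det-near-monomial {n} {δ} 0≤δ b π r P P≤b P≤δ =
    subst (_≤ _) (∥∥-cong (+-congˡ (-‿cong detQ))) (Close.error (det-close 0≤δ b close))
    where
    Q : Matrix Carrier n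
    Q k c with toℕ k ℕₚ.≟ r | c ≟ᶠ π ⟨$⟩ʳ k
    ... | no _  | no _ = 0#
    ... | yes _ | _    = P k c
    ... | no _ | yes _ = P k c
    close : ∀ k c → Close (b k) δ (P k c) (Q k c)
    close k c with toℕ k ℕₚ.≟ r | c ≟ᶠ π ⟨$⟩ʳ k
    ... | no k≢r | no c≢ = mkClose (P≤b k c) (ℚₚ.≤-trans ∥0∥≤0 (ℚₚ.≤-trans (0≤∥∥ (P k c)) (P≤b k c)))
      (subst (_≤ _) (∥∥-cong (≈-sym (≈-trans (+-congˡ -0≈0) (+-identityʳ (P k c))))) (P≤δ k c k≢r c≢))
      where
      -0≈0 : - 0# ≈ 0#
      -0≈0 = ≈-trans (≈-sym (+-identityˡ (- 0#))) (-‿inverseʳ 0#)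
    ... | yes _  | _     = close-refl 0≤δ (P≤b k c)
    ... | no _   | yes _ = close-refl 0≤δ (P≤b k c)
    Q-zero : ∀ k c → toℕ k ≢ r → c ≢ π ⟨$⟩ʳ k → Q k c ≈ 0#
    Q-zero k c k≢r c≢ with toℕ k ℕₚ.≟ r | c ≟ᶠ π ⟨$⟩ʳ k
    ... | no _    | no _   = ≈-refl
    ... | yes k≡r | _      = contradiction k≡r k≢r
    ... | no _    | yes c≡ = contradiction c≡ c≢
    Q-π : ∀ k → Q k (π ⟨$⟩ʳ k) ≈ P k (π ⟨$⟩ʳ k)
    Q-π k with toℕ k ℕₚ.≟ r | π ⟨$⟩ʳ k ≟ᶠ π ⟨$⟩ʳ k
    ... | no _  | no ¬eq = contradiction refl ¬eq
    ... | yes _ | _      = ≈-refl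
    ... | no _  | yes _  = ≈-refl
    detQ : det rawRing Q ≈ sgn rawRing π * product (λ k → P k (π ⟨$⟩ʳ k))
    detQ = ≈-trans (DetProperties.det-monomial R π r Q Q-zero)
      (*-congˡ (CMSum.sum-cong-≋ *-commutativeMonoid Q-π))

-- ℚ[x]/(x² - t x), with (a , b) standing for a + b x.  It is ℚ × ℚ via x ↦ 0 and x ↦ t when t ≠ 0,
-- and the dual numbers when t = 0, so it treats difference quotients and derivatives alike.
module _ (t : ℚ) where
  infixl 6 _+ₓ_
  infixl 7 _*ₓ_

  _+ₓ_ _*ₓ_ : ℚ × ℚ → ℚ × ℚ → ℚ × ℚ
  (a , b) +ₓ (c , d) = a +ℚ c , b +ℚ d
  (a , b) *ₓ (c , d) = a *ℚ c , a *ℚ d +ℚ b *ℚ c +ℚ t *ℚ (b *ℚ d)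

  -ₓ_ : ℚ × ℚ → ℚ × ℚ
  -ₓ (a , b) = -ℚ a , -ℚ b

  private
    *ₓ-comm : ∀ x y → x *ₓ y ≡ y *ₓ x
    *ₓ-comm (a , b) (c , d) = cong₂ _,_ (ℚₚ.*-comm a c)
      (solve 5 (λ t a b c d → a :* d :+ b :* c :+ t :* (b :* d) := c :* b :+ d :* a :+ t :* (d :* b)) refl t a b c d)

    *ₓ-assoc : ∀ x y z → (x *ₓ y) *ₓ z ≡ x *ₓ (y *ₓ z)
    *ₓ-assoc (a , b) (c , d) (e , f) = cong₂ _,_ (ℚₚ.*-assoc a c e)
      (solve 7 (λ t a b c d e f →
        a :* c :* f :+ (a :* d :+ b :* c :+ t :* (b :* d)) :* e :+ t :* ((a :* d :+ b :* c :+ t :* (b :* d)) :* f)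
        := a :* (c :* f :+ d :* e :+ t :* (d :* f)) :+ b :* (c :* e) :+ t :* (b :* (c :* f :+ d :* e :+ t :* (d :* f))))
        refl t a b c d e f)

    *ₓ-identityˡ : ∀ x → (1ℚ , 0ℚ) *ₓ x ≡ x
    *ₓ-identityˡ (a , b) = cong₂ _,_ (ℚₚ.*-identityˡ a)
      (solve 3 (λ t a b → con 1ℚ :* b :+ con 0ℚ :* a :+ t :* (con 0ℚ :* b) := b) refl t a b)

    *ₓ-distribˡ : ∀ x y z → x *ₓ (y +ₓ z) ≡ x *ₓ y +ₓ x *ₓ z
    *ₓ-distribˡ (a , b) (c , d) (e , f) = cong₂ _,_ (ℚₚ.*-distribˡ-+ a c e)
      (solve 7 (λ t a b c d e f →
        a :* (d :+ f) :+ b :* (c :+ e) :+ t :* (b :* (d :+ f))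
        := (a :* d :+ b :* c :+ t :* (b :* d)) :+ (a :* f :+ b :* e :+ t :* (b :* f)))
        refl t a b c d e f)

  difference-ring : CommutativeRing 0ℓ 0ℓ
  difference-ring = record
    { Carrier = ℚ × ℚ
    ; _≈_ = _≡_
    ; _+_ = _+ₓ_
    ; _*_ = _*ₓ_
    ; -_ = -ₓ_
    ; 0# = 0ℚ , 0ℚ
    ; 1# = 1ℚ , 0ℚ
    ; isCommutativeRing = record
      { isRing = record
        { +-isAbelianGroup = record
          { isGroup = record
            { isMonoid = record
              { isSemigroup = record
                { isMagma = record { isEquivalence = isEquivalence ; ∙-cong = cong₂ _+ₓ_ }
                ; assoc = λ (a , b) (c , d) (e , f) → cong₂ _,_ (ℚₚ.+-assoc a c e) (ℚₚ.+-assoc b d f)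
                }
              ; identity = (λ (a , b) → cong₂ _,_ (ℚₚ.+-identityˡ a) (ℚₚ.+-identityˡ b))
                         , (λ (a , b) → cong₂ _,_ (ℚₚ.+-identityʳ a) (ℚₚ.+-identityʳ b))
              }
            ; inverse = (λ (a , b) → cong₂ _,_ (ℚₚ.+-inverseˡ a) (ℚₚ.+-inverseˡ b))
                      , (λ (a , b) → cong₂ _,_ (ℚₚ.+-inverseʳ a) (ℚₚ.+-inverseʳ b))
            ; ⁻¹-cong = cong -ₓ_
            }
          ; comm = λ (a , b) (c , d) → cong₂ _,_ (ℚₚ.+-comm a c) (ℚₚ.+-comm b d)
          }
        ; *-cong = cong₂ _*ₓ_
        ; *-assoc = *ₓ-assoc
        ; *-identity = *ₓ-identityˡ , λ x → trans (*ₓ-comm x (1ℚ , 0ℚ)) (*ₓ-identityˡ x)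
        ; distrib = *ₓ-distribˡ , λ x y z → trans (*ₓ-comm (y +ₓ z) x)
            (trans (*ₓ-distribˡ x y z) (cong₂ _+ₓ_ (*ₓ-comm x y) (*ₓ-comm x z)))
        }
      ; *-comm = *ₓ-comm
      }
    }

  private
    D : RawRing 0ℓ 0ℓ
    D = CommutativeRing.rawRing difference-ring

  constant : StrictHom ℚ-rawRing D
  constant = record
    { ⟦_⟧ = λ a → a , 0ℚ
    ; +-hom = λ _ _ → refl
    ; *-hom = λ a b → cong (a *ℚ b ,_)
        (solve 3 (λ t a b → con 0ℚ := a :* con 0ℚ :+ con 0ℚ :* b :+ t :* (con 0ℚ :* con 0ℚ)) refl t a b)
    ; neg-hom = λ _ → refl
    ; 0#-hom = refl
    ; 1#-hom = refl
    }

  eval-0 : StrictHom D ℚ-rawRing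
  eval-0 = record
    { ⟦_⟧ = proj₁
    ; +-hom = λ _ _ → refl
    ; *-hom = λ _ _ → refl
    ; neg-hom = λ _ → refl
    ; 0#-hom = refl
    ; 1#-hom = refl
    }

  -- Multiplicative because x = t solves x² = t x. Together with `eval-0` it shows that the second
  -- coordinate of a polynomial expression at c + x e is its difference quotient between c and c + t
  -- e.
  eval-t : StrictHom D ℚ-rawRing
  eval-t = record
    { ⟦_⟧ = λ (a , b) → a +ℚ t *ℚ b
    ; +-hom = λ (a , b) (c , d) →
        solve 5 (λ t a b c d → a :+ c :+ t :* (b :+ d) := (a :+ t :* b) :+ (c :+ t :* d)) refl t a b c d
    ; *-hom = λ (a , b) (c , d) →
        solve 5 (λ t a b c d → a :* c :+ t :* (a :* d :+ b :* c :+ t :* (b :* d)) := (a :+ t :* b) :* (c :+ t :* d))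
          refl t a b c d
    ; neg-hom = λ (a , b) → solve 3 (λ t a b → (:- a) :+ t :* (:- b) := :- (a :+ t :* b)) refl t a b
    ; 0#-hom = solve 1 (λ t → con 0ℚ :+ t :* con 0ℚ := con 0ℚ) refl t
    ; 1#-hom = solve 1 (λ t → con 1ℚ :+ t :* con 0ℚ := con 1ℚ) refl t
    }

  -- The ℓ¹ norm is submultiplicative because x² = t x has norm t, which is at most 1.
  difference-norm : 0ℚ ≤ t → t ≤ 1ℚ → SubmultiplicativeNorm difference-ring
  difference-norm 0≤t t≤1 = record
    { ∥_∥ = λ (a , b) → ∣ a ∣ +ℚ ∣ b ∣
    ; ∥∥-cong = cong _
    ; 0≤∥∥ = λ (a , b) → +-nonNegℚ (ℚₚ.0≤∣p∣ a) (ℚₚ.0≤∣p∣ b)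
    ; ∥0∥≤0 = ℚₚ.≤-refl
    ; ∥1∥≤1 = ℚₚ.≤-refl
    ; ∥-1∥≤1 = ℚₚ.≤-refl
    ; ∥x+y∥≤ = λ (a , b) (c , d) → ℚₚ.≤-trans
        (ℚₚ.+-mono-≤ (ℚₚ.∣p+q∣≤∣p∣+∣q∣ a c) (ℚₚ.∣p+q∣≤∣p∣+∣q∣ b d))
        (ℚₚ.≤-reflexive (solve 4 (λ a b c d → (a :+ c) :+ (b :+ d) := (a :+ b) :+ (c :+ d)) refl
          (∣ a ∣) (∣ b ∣) (∣ c ∣) (∣ d ∣)))
    ; ∥x*y∥≤ = submultiplicative
    }
    where
    open ℚₚ.≤-Reasoning
    submultiplicative : ∀ ((a , b) (c , d) : ℚ × ℚ) →
      ∣ a *ℚ c ∣ +ℚ ∣ a *ℚ d +ℚ b *ℚ c +ℚ t *ℚ (b *ℚ d) ∣ ≤ (∣ a ∣ +ℚ ∣ b ∣) *ℚ (∣ c ∣ +ℚ ∣ d ∣)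
    submultiplicative (a , b) (c , d) = begin
      ∣ a *ℚ c ∣ +ℚ ∣ a *ℚ d +ℚ b *ℚ c +ℚ t *ℚ (b *ℚ d) ∣
        ≤⟨ ℚₚ.+-monoʳ-≤ (∣ a *ℚ c ∣) (ℚₚ.≤-trans (ℚₚ.∣p+q∣≤∣p∣+∣q∣ (a *ℚ d +ℚ b *ℚ c) (t *ℚ (b *ℚ d)))
             (ℚₚ.+-monoˡ-≤ (∣ t *ℚ (b *ℚ d) ∣) (ℚₚ.∣p+q∣≤∣p∣+∣q∣ (a *ℚ d) (b *ℚ c)))) ⟩
      ∣ a *ℚ c ∣ +ℚ (∣ a *ℚ d ∣ +ℚ ∣ b *ℚ c ∣ +ℚ ∣ t *ℚ (b *ℚ d) ∣)
        ≡⟨ cong₂ _+ℚ_ (ℚₚ.∣p*q∣≡∣p∣*∣q∣ a c) (cong₂ _+ℚ_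
             (cong₂ _+ℚ_ (ℚₚ.∣p*q∣≡∣p∣*∣q∣ a d) (ℚₚ.∣p*q∣≡∣p∣*∣q∣ b c))
             (trans (ℚₚ.∣p*q∣≡∣p∣*∣q∣ t (b *ℚ d)) (cong₂ _*ℚ_ (ℚₚ.0≤p⇒∣p∣≡p 0≤t) (ℚₚ.∣p*q∣≡∣p∣*∣q∣ b d)))) ⟩
      ∣ a ∣ *ℚ ∣ c ∣ +ℚ (∣ a ∣ *ℚ ∣ d ∣ +ℚ ∣ b ∣ *ℚ ∣ c ∣ +ℚ t *ℚ (∣ b ∣ *ℚ ∣ d ∣))
        ≤⟨ ℚₚ.+-monoʳ-≤ (∣ a ∣ *ℚ ∣ c ∣) (ℚₚ.+-monoʳ-≤ (∣ a ∣ *ℚ ∣ d ∣ +ℚ ∣ b ∣ *ℚ ∣ c ∣)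
             (ℚₚ.*-monoʳ-≤-nonNeg (∣ b ∣ *ℚ ∣ d ∣)
               {{nonNegative (*-nonNegℚ (ℚₚ.0≤∣p∣ b) (ℚₚ.0≤∣p∣ d))}} t≤1)) ⟩
      ∣ a ∣ *ℚ ∣ c ∣ +ℚ (∣ a ∣ *ℚ ∣ d ∣ +ℚ ∣ b ∣ *ℚ ∣ c ∣ +ℚ 1ℚ *ℚ (∣ b ∣ *ℚ ∣ d ∣))
        ≡⟨ solve 4 (λ a b c d → a :* c :+ (a :* d :+ b :* c :+ con 1ℚ :* (b :* d)) := (a :+ b) :* (c :+ d)) refl
             (∣ a ∣) (∣ b ∣) (∣ c ∣) (∣ d ∣) ⟩
      (∣ a ∣ +ℚ ∣ b ∣) *ℚ (∣ c ∣ +ℚ ∣ d ∣) ∎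

ℚ-norm : SubmultiplicativeNorm ℚ-commutativeRing
ℚ-norm = record
  { ∥_∥ = ∣_∣
  ; ∥∥-cong = cong ∣_∣
  ; 0≤∥∥ = ℚₚ.0≤∣p∣
  ; ∥0∥≤0 = ℚₚ.≤-refl
  ; ∥1∥≤1 = ℚₚ.≤-refl
  ; ∥-1∥≤1 = ℚₚ.≤-refl
  ; ∥x+y∥≤ = ℚₚ.∣p+q∣≤∣p∣+∣q∣
  ; ∥x*y∥≤ = λ p q → ℚₚ.≤-reflexive (ℚₚ.∣p*q∣≡∣p∣*∣q∣ p q)
  }

half^ : ℕ → ℚ
half^ zero    = 1ℚ
half^ (suc k) = ½ *ℚ half^ k

0≤½ : 0ℚ ≤ ½
0≤½ = ℚₚ.nonNegative⁻¹ ½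

½≤1 : ½ ≤ 1ℚ
½≤1 = ℚₚ.+-monoʳ-≤ ½ {0ℚ} {½} 0≤½

0≤half^ : ∀ k → 0ℚ ≤ half^ k
0≤half^ zero    = 0≤1
0≤half^ (suc k) = *-nonNegℚ 0≤½ (0≤half^ k)

half^≤1 : ∀ k → half^ k ≤ 1ℚ
half^≤1 zero    = ℚₚ.≤-refl
half^≤1 (suc k) = *-mono-≤ℚ {q = 1ℚ} 0≤½ 0≤1 ½≤1 (half^≤1 k)

half^-antitone : ∀ {m k} → m ≤ℕ k → half^ k ≤ half^ m
half^-antitone {k = k} z≤n = half^≤1 k
half^-antitone (s≤s m≤k) = ℚₚ.*-monoˡ-≤-nonNeg ½ (half^-antitone m≤k)

D : ℚ → RawRing 0ℓ 0ℓ
D t = CommutativeRing.rawRing (difference-ring t)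

deleteAt-cong : ∀ {A : Set} {n} {M M′ : Matrix A (suc n)} → (∀ i j → M i j ≡ M′ i j) →
  ∀ i j k → deleteAt M i j k ≡ deleteAt M′ i j k
deleteAt-cong eq i j k = eq (punchIn i j) (punchIn i k)

withDiagonal : ∀ {A : Set} {n} → Vector A n → Matrix A n → Matrix A n
withDiagonal d W i j = if does (i ≟ᶠ j) then d i else W i j

withDiagonal-map : ∀ {A B : Set} {n} (f : A → B) (d : Vector A n) (W : Matrix A n) i j →
  f (withDiagonal d W i j) ≡ withDiagonal (f ∘ d) (λ k l → f (W k l)) i j
withDiagonal-map f d W i j with i ≟ᶠ j
... | yes _ = refl
... | no _  = refl

-- The matching as a permutation, with and without a deleted vertex

module Matching {n} (μ : Fin (suc n) → Fin (suc n)) (μ-involutive : ∀ i → μ (μ i) ≡ i)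
  (i≢μi : ∀ i → i ≢ μ i) where

  private
    module _ (i : Fin (suc n)) where
      -- `μ` itself does not restrict to the vertices other than `i`, since it sends `μ i` to `i`.
      -- Fixing both ends of this edge repairs that, and the fixed point `μ i` picks the diagonal
      -- entry η c (μ i) in the leading term of the minor.
      fixPair : Fin (suc n) → Fin (suc n)
      fixPair j with j ≟ᶠ i | j ≟ᶠ μ i
      ... | yes _ | _     = j
      ... | no _  | yes _ = j
      ... | no _  | no _  = μ j

      fixPair-i : fixPair i ≡ i
      fixPair-i with i ≟ᶠ i | i ≟ᶠ μ i
      ... | yes _ | _     = refl
      ... | no _  | yes _ = refl
      ... | no ¬p | no _  = contradiction refl ¬p

      fixPair-μi : fixPair (μ i) ≡ μ i
      fixPair-μi with μ i ≟ᶠ i | μ i ≟ᶠ μ i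
      ... | yes _ | _     = refl
      ... | no _  | yes _ = refl
      ... | no _  | no ¬p = contradiction refl ¬p

      fixPair-other : ∀ {j} → j ≢ i → j ≢ μ i → fixPair j ≡ μ j
      fixPair-other {j} j≢i j≢μi with j ≟ᶠ i | j ≟ᶠ μ i
      ... | yes p | _     = contradiction p j≢i
      ... | no _  | yes p = contradiction p j≢μi
      ... | no _  | no _  = refl

      fixPair-involutive : ∀ j → fixPair (fixPair j) ≡ j
      fixPair-involutive j = by-cases (j ≟ᶠ i) (j ≟ᶠ μ i)
        where
        by-cases : Dec (j ≡ i) → Dec (j ≡ μ i) → fixPair (fixPair j) ≡ j
        by-cases (yes refl) _          = trans (cong fixPair fixPair-i) fixPair-i
        by-cases (no _)     (yes refl) = trans (cong fixPair fixPair-μi) fixPair-μi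
        by-cases (no j≢i)   (no j≢μi)  = trans (cong fixPair (fixPair-other j≢i j≢μi))
          (trans (fixPair-other
                   (λ μj≡i → j≢μi (trans (sym (μ-involutive j)) (cong μ μj≡i)))
                   (λ μj≡μi → j≢i (trans (sym (μ-involutive j)) (trans (cong μ μj≡μi) (μ-involutive i)))))
                 (μ-involutive j))

      fixPair-permutation : Permutation′ (suc n)
      fixPair-permutation = permutation fixPair fixPair fixPair-involutive fixPair-involutive

  μ-permutation : Permutation′ (suc n)
  μ-permutation = permutation μ μ μ-involutive μ-involutive

  -- On the vertices other than i, this is μ, except that the partner of i is fixed.
  matchingWithout : Fin (suc n) → Permutation′ n
  matchingWithout i = remove i (fixPair-permutation i)

  partner : Fin (suc n) → Fin n
  partner i = punchOut (i≢μi i)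

  punchIn-partner : ∀ i → punchIn i (partner i) ≡ μ i
  punchIn-partner i = punchIn-punchOut (i≢μi i)

  private
    punchIn-matching : ∀ i k → punchIn i (matchingWithout i ⟨$⟩ʳ k) ≡ fixPair i (punchIn i k)
    punchIn-matching i k = trans
      (cong (λ j → punchIn j (matchingWithout i ⟨$⟩ʳ k)) (sym (fixPair-i i)))
      (sym (punchIn-permute (fixPair-permutation i) i k))

  matching-partner : ∀ i → matchingWithout i ⟨$⟩ʳ partner i ≡ partner i
  matching-partner i = punchIn-injective i _ _
    (trans (punchIn-matching i (partner i))
      (trans (cong (fixPair i) (punchIn-partner i)) (trans (fixPair-μi i) (sym (punchIn-partner i)))))

  matching-other : ∀ i {k} → k ≢ partner i → punchIn i (matchingWithout i ⟨$⟩ʳ k) ≡ μ (punchIn i k)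
  matching-other i {k} k≢r = trans (punchIn-matching i k) (fixPair-other i (punchInᵢ≢i i k)
    λ eq → k≢r (punchIn-injective i _ _ (trans eq (sym (punchIn-partner i)))))

-- The Newton iteration for the minors

module Fixpoint {n} (μ : Fin (suc n) → Fin (suc n)) (μ-involutive : ∀ i → μ (μ i) ≡ i)
  (i≢μi : ∀ i → i ≢ μ i)
  (W : Matrix ℚ (suc n)) (W-μ : ∀ i → W i (μ i) ≡ 1ℚ)
  (η H : ℚ) (0≤η : 0ℚ ≤ η) (η≤1 : η ≤ 1ℚ) (0≤H : 0ℚ ≤ H) (Hη≡1 : H *ℚ η ≡ 1ℚ) (W≤η : ∀ i j → j ≢ μ i → ∣ W i j ∣ ≤ η)
  (2η≤1 : η +ℚ η ≤ 1ℚ)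
  (η-small : (fromℕ n *ℚ (η +ℚ η)) *ℚ (factorial n *ℚ (η +ℚ η)) ≤ ½ *ℚ η)
  where
  open Matching μ μ-involutive i≢μi public

  2η : ℚ
  2η = η +ℚ η

  0≤2η : 0ℚ ≤ 2η
  0≤2η = +-nonNegℚ 0≤η 0≤η

  ∣ηq∣≤η : ∀ q → ∣ q ∣ ≤ 1ℚ → ∣ η *ℚ q ∣ ≤ η
  ∣ηq∣≤η q q≤1 = begin
    ∣ η *ℚ q ∣        ≡⟨ ℚₚ.∣p*q∣≡∣p∣*∣q∣ η q ⟩
    ∣ η ∣ *ℚ ∣ q ∣    ≡⟨ cong (_*ℚ ∣ q ∣) (ℚₚ.0≤p⇒∣p∣≡p 0≤η) ⟩
    η *ℚ ∣ q ∣        ≤⟨ ℚₚ.*-monoˡ-≤-nonNeg η {{nonNegative 0≤η}} q≤1 ⟩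
    η *ℚ 1ℚ           ≡⟨ ℚₚ.*-identityʳ η ⟩
    η                 ∎
    where open ℚₚ.≤-Reasoning

  -- This is -A, so that charPoly A is det (X I + B).
  B : Vector ℚ (suc n) → Matrix ℚ (suc n)
  B c = withDiagonal (λ i → η *ℚ c i) W

  module _ (t : ℚ) where
    -- This is `B` at c + x e: determinants of its submatrices carry the value at `c` and the
    -- difference quotient in direction `e` with step `t`, a derivative when t = 0.
    B̂ : (c e : Vector ℚ (suc n)) → Matrix (ℚ × ℚ) (suc n)
    B̂ c e = withDiagonal (λ i → η *ℚ c i , η *ℚ e i) (λ i j → W i j , 0ℚ)

    minor^ : (c e : Vector ℚ (suc n)) → Fin (suc n) → ℚ × ℚ
    minor^ c e i = det (D t) (deleteAt (B̂ c e) i)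

  minor : Vector ℚ (suc n) → Fin (suc n) → ℚ
  minor c i = det ℚ-rawRing (deleteAt (B c) i)

  σ : Fin (suc n) → ℚ
  σ i = sgn ℚ-rawRing (matchingWithout i)

  InBox : Vector ℚ (suc n) → Set
  InBox c = ∀ i → ∣ c i ∣ ≤ 1ℚ

  module _ {t} (0≤t : 0ℚ ≤ t) (t≤1 : t ≤ 1ℚ) (c e : Vector ℚ (suc n)) (c≤1 : InBox c) (e≤1 : InBox e) where
    private
      module R = CommutativeRing (difference-ring t)
      module N = SubmultiplicativeNorm (difference-norm t 0≤t t≤1)
      open N using (∥_∥)

      entry-small : ∀ i j → j ≢ μ i → ∥ B̂ t c e i j ∥ ≤ 2η
      entry-small i j j≢ with i ≟ᶠ j
      ... | yes _ = ℚₚ.+-mono-≤ (∣ηq∣≤η (c i) (c≤1 i)) (∣ηq∣≤η (e i) (e≤1 i))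
      ... | no _  = ℚₚ.+-mono-≤ (W≤η i j j≢) 0≤η

      entry-μ : ∀ i → B̂ t c e i (μ i) ≡ (1ℚ , 0ℚ)
      entry-μ i with i ≟ᶠ μ i
      ... | yes p = contradiction p (i≢μi i)
      ... | no _  = cong (_, 0ℚ) (W-μ i)

      entry-≤1 : ∀ i j → ∥ B̂ t c e i j ∥ ≤ 1ℚ
      entry-≤1 i j with j ≟ᶠ μ i
      ... | yes refl = subst (λ z → ∥ z ∥ ≤ 1ℚ) (sym (entry-μ i)) ℚₚ.≤-refl
      ... | no j≢    = ℚₚ.≤-trans (entry-small i j j≢) 2η≤1

      module _ (i : Fin (suc n)) where
        r = partner i
        π = matchingWithout i
        P = deleteAt (B̂ t c e) i

        -- Row `r` of `P` comes from vertex `μ i`, whose matching entry lies in the deleted column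
        -- `i`, so all its entries are small. Its scale 2η makes the absolute error of the minor of
        -- second order in η.
        weight : Vector ℚ n
        weight k = if does (k ≟ᶠ r) then 2η else 1ℚ

        weight-r : weight r ≡ 2η
        weight-r with r ≟ᶠ r
        ... | yes _ = refl
        ... | no ¬p = contradiction refl ¬p

        weight-other : ∀ k → k ≢ r → weight k ≡ 1ℚ
        weight-other k k≢r with k ≟ᶠ r
        ... | yes p = contradiction p k≢r
        ... | no _  = refl

        P≤weight : ∀ k l → ∥ P k l ∥ ≤ weight k
        P≤weight k l with k ≟ᶠ r
        ... | yes refl = entry-small (punchIn i r) (punchIn i l)
          λ eq → punchInᵢ≢i i l (trans eq (trans (cong μ (punchIn-partner i)) (μ-involutive i)))
        ... | no _     = entry-≤1 (punchIn i k) (punchIn i l)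

        P≤2η : ∀ k l → toℕ k ≢ toℕ r → l ≢ π ⟨$⟩ʳ k → ∥ P k l ∥ ≤ 2η *ℚ weight k
        P≤2η k l k≢r l≢ = subst (∥ P k l ∥ ≤_)
          (sym (trans (cong (2η *ℚ_) (weight-other k (k≢r ∘ cong toℕ))) (ℚₚ.*-identityʳ 2η)))
          (entry-small (punchIn i k) (punchIn i l) λ eq →
            l≢ (punchIn-injective i _ _ (trans eq (sym (matching-other i (k≢r ∘ cong toℕ))))))

        P-partner : P r r ≡ (η *ℚ c (μ i) , η *ℚ e (μ i))
        P-partner rewrite punchIn-partner i with μ i ≟ᶠ μ i
        ... | yes _ = refl
        ... | no ¬p = contradiction refl ¬p

        product-P : CMSum.sum R.*-commutativeMonoid (λ k → P k (π ⟨$⟩ʳ k)) ≡ (η *ℚ c (μ i) , η *ℚ e (μ i))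
        product-P = trans (sum-single R.*-commutativeMonoid _ r λ k k≢r →
            trans (cong (B̂ t c e (punchIn i k)) (matching-other i k≢r)) (entry-μ (punchIn i k)))
          (trans (cong (P r) (matching-partner i)) P-partner)

        product-weight : productℚ weight ≡ 2η
        product-weight = trans (sum-single (CommutativeRing.*-commutativeMonoid ℚ-commutativeRing) weight r weight-other)
          weight-r

        sgn-π : sgn (D t) π ≡ (σ i , 0ℚ)
        sgn-π = sym (StrictHom.sgn-hom (constant t) π)

        scalar : ∀ s a b → (s , 0ℚ) R.* (a , b) ≡ (s *ℚ a , s *ℚ b)
        scalar s a b = cong (s *ℚ a ,_)
          (solve 4 (λ t s a b → s :* b :+ con 0ℚ :* a :+ t :* (con 0ℚ :* b) := s :* b) refl t s a b)

    -- Along `π` every row except the partner's contributes the matching entry 1, which leaves σ i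
    -- times the diagonal entry at `μ i`. The norm adds both coordinates, so the minor and its
    -- difference quotient are estimated at once.
    minor^-near : ∀ i →
      ∣ proj₁ (minor^ t c e i) -ℚ σ i *ℚ (η *ℚ c (μ i)) ∣ +ℚ ∣ proj₂ (minor^ t c e i) -ℚ σ i *ℚ (η *ℚ e (μ i)) ∣
        ≤ ½ *ℚ η
    minor^-near i = ℚₚ.≤-trans
      (subst₂ _≤_
        (cong (λ z → ∥ minor^ t c e i R.+ R.- z ∥)
          (trans (cong₂ R._*_ (sgn-π i) (product-P i)) (scalar i (σ i) _ _)))
        (cong (λ z → (fromℕ n *ℚ 2η) *ℚ (factorial n *ℚ z)) (product-weight i))
        (Perturbation.det-near-monomial (difference-norm t 0≤t t≤1) 0≤2η (weight i) (π i) (toℕ (r i)) (P i)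
          (P≤weight i) (P≤2η i)))
      η-small

  σ*σ≡1 : ∀ i → σ i *ℚ σ i ≡ 1ℚ
  σ*σ≡1 i = DetProperties.sgn*sgn≈1 ℚ-commutativeRing (matchingWithout i)

  ∣σ∣≤1 : ∀ i → ∣ σ i ∣ ≤ 1ℚ
  ∣σ∣≤1 i = Perturbation.∥sgn∥≤1 ℚ-norm (matchingWithout i)

  -- σ i η is the diagonal approximation of the derivative of minor i, and its inverse is σ i H.
  newton : ℚ → Fin (suc n) → ℚ → ℚ
  newton v i x = v -ℚ (σ i *ℚ H) *ℚ x

  -- Since σ² = 1 and H η = 1, the result is - σ H times the deviation of `x` from σ η v, and H
  -- turns ½ η into ½. With `x` a minor this shows that `T` maps the box into its half; with `x` a
  -- difference quotient, that `T` contracts by ½.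
  newton≤½ : ∀ v i x → ∣ x -ℚ σ i *ℚ (η *ℚ v) ∣ ≤ ½ *ℚ η → ∣ newton v i x ∣ ≤ ½
  newton≤½ v i x x≤ = begin
    ∣ v -ℚ (σ i *ℚ H) *ℚ x ∣
      ≡⟨ cong (λ z → ∣ z -ℚ (σ i *ℚ H) *ℚ x ∣) expand ⟩
    ∣ (σ i *ℚ σ i) *ℚ (H *ℚ η) *ℚ v -ℚ (σ i *ℚ H) *ℚ x ∣
      ≡⟨ cong ∣_∣ (solve 5 (λ s H η v x →
           (s :* s) :* (H :* η) :* v :- (s :* H) :* x := :- (s :* (H :* (x :- s :* (η :* v))))) refl (σ i) H η v x) ⟩
    ∣ -ℚ (σ i *ℚ (H *ℚ d)) ∣
      ≡⟨ ℚₚ.∣-p∣≡∣p∣ (σ i *ℚ (H *ℚ d)) ⟩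
    ∣ σ i *ℚ (H *ℚ d) ∣
      ≡⟨ trans (ℚₚ.∣p*q∣≡∣p∣*∣q∣ (σ i) (H *ℚ d)) (cong (∣ σ i ∣ *ℚ_)
           (trans (ℚₚ.∣p*q∣≡∣p∣*∣q∣ H d) (cong (_*ℚ ∣ d ∣) (ℚₚ.0≤p⇒∣p∣≡p 0≤H)))) ⟩
    ∣ σ i ∣ *ℚ (H *ℚ ∣ d ∣)
      ≤⟨ *-mono-≤ℚ (ℚₚ.0≤∣p∣ (σ i)) (*-nonNegℚ 0≤H (*-nonNegℚ 0≤½ 0≤η)) (∣σ∣≤1 i)
           (ℚₚ.*-monoˡ-≤-nonNeg H {{nonNegative 0≤H}} x≤) ⟩
    1ℚ *ℚ (H *ℚ (½ *ℚ η))
      ≡⟨ solve 2 (λ H η → con 1ℚ :* (H :* (con ½ :* η)) := con ½ :* (H :* η)) refl H η ⟩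
    ½ *ℚ (H *ℚ η)
      ≡⟨ cong (½ *ℚ_) Hη≡1 ⟩
    ½ ∎
    where
    open ℚₚ.≤-Reasoning
    d = x -ℚ σ i *ℚ (η *ℚ v)
    expand : v ≡ (σ i *ℚ σ i) *ℚ (H *ℚ η) *ℚ v
    expand = sym (trans (cong (_*ℚ v) (cong₂ _*ℚ_ (σ*σ≡1 i) Hη≡1)) (ℚₚ.*-identityˡ v))

  -- Coordinate `j` is corrected by the minor at `μ j`, because to first order minor `i` depends on
  -- c (μ i) alone.
  T : Vector ℚ (suc n) → Vector ℚ (suc n)
  T c j = newton (c j) (μ j) (minor c (μ j))

  T^ : ℚ → (c e : Vector ℚ (suc n)) → Vector ℚ (suc n)
  T^ t c e j = newton (e j) (μ j) (proj₂ (minor^ t c e (μ j)))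

  infixl 6 _⊕_
  _⊕_ : Vector ℚ (suc n) → Vector ℚ (suc n) → Vector ℚ (suc n)
  (c ⊕ e) j = c j +ℚ e j

  infixl 7 _⊙_
  _⊙_ : ℚ → Vector ℚ (suc n) → Vector ℚ (suc n)
  (t ⊙ e) j = t *ℚ e j

  minor-eval-0 : ∀ t c e i → proj₁ (minor^ t c e i) ≡ minor c i
  minor-eval-0 t c e i = StrictHom.det-hom (eval-0 t) (deleteAt-cong entries i)
    where
    entries : ∀ k l → proj₁ (B̂ t c e k l) ≡ B c k l
    entries k l with k ≟ᶠ l
    ... | yes _ = refl
    ... | no _  = refl

  minor-eval-t : ∀ t c e i → proj₁ (minor^ t c e i) +ℚ t *ℚ proj₂ (minor^ t c e i) ≡ minor (c ⊕ t ⊙ e) i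
  minor-eval-t t c e i = StrictHom.det-hom (eval-t t) (deleteAt-cong entries i)
    where
    entries : ∀ k l → proj₁ (B̂ t c e k l) +ℚ t *ℚ proj₂ (B̂ t c e k l) ≡ B (c ⊕ t ⊙ e) k l
    entries k l with k ≟ᶠ l
    ... | yes _ = solve 4 (λ η c t e → η :* c :+ t :* (η :* e) := η :* (c :+ t :* e)) refl η (c k) t (e k)
    ... | no _  = solve 2 (λ w t → w :+ t :* con 0ℚ := w) refl (W k l) t

  -- An exact identity that takes the place of the mean value theorem: bounding `T^` bounds how far
  -- `T` moves along a step t e.
  T-difference : ∀ t c e j → T (c ⊕ t ⊙ e) j ≡ T c j +ℚ t *ℚ T^ t c e j
  T-difference t c e j = trans
    (cong (newton ((c ⊕ t ⊙ e) j) (μ j)) (trans (sym (minor-eval-t t c e (μ j)))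
      (cong (_+ℚ t *ℚ proj₂ (minor^ t c e (μ j))) (minor-eval-0 t c e (μ j)))))
    (solve 6 (λ c t e s x y → (c :+ t :* e) :- s :* (x :+ t :* y) := (c :- s :* x) :+ t :* (e :- s :* y)) refl
      (c j) t (e j) (σ (μ j) *ℚ H) (minor c (μ j)) (proj₂ (minor^ t c e (μ j))))

  ≤-sumˡ : ∀ p q {z} → ∣ p ∣ +ℚ ∣ q ∣ ≤ z → ∣ p ∣ ≤ z
  ≤-sumˡ p q = ℚₚ.≤-trans (subst (_≤ ∣ p ∣ +ℚ ∣ q ∣) (ℚₚ.+-identityʳ (∣ p ∣)) (ℚₚ.+-monoʳ-≤ (∣ p ∣) (ℚₚ.0≤∣p∣ q)))

  ≤-sumʳ : ∀ p q {z} → ∣ p ∣ +ℚ ∣ q ∣ ≤ z → ∣ q ∣ ≤ z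
  ≤-sumʳ p q = ℚₚ.≤-trans (subst (_≤ ∣ p ∣ +ℚ ∣ q ∣) (ℚₚ.+-identityˡ (∣ q ∣)) (ℚₚ.+-monoˡ-≤ (∣ q ∣) (ℚₚ.0≤∣p∣ p)))

  minor^-near₂ : ∀ {t} (0≤t : 0ℚ ≤ t) (t≤1 : t ≤ 1ℚ) c e → InBox c → InBox e → ∀ i →
    ∣ proj₂ (minor^ t c e i) -ℚ σ i *ℚ (η *ℚ e (μ i)) ∣ ≤ ½ *ℚ η
  minor^-near₂ {t} 0≤t t≤1 c e c≤1 e≤1 i =
    ≤-sumʳ (proj₁ (minor^ t c e i) -ℚ σ i *ℚ (η *ℚ c (μ i))) _ (minor^-near 0≤t t≤1 c e c≤1 e≤1 i)

  T^≤½ : ∀ {t} (0≤t : 0ℚ ≤ t) (t≤1 : t ≤ 1ℚ) c e → InBox c → InBox e → ∀ j → ∣ T^ t c e j ∣ ≤ ½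
  T^≤½ {t} 0≤t t≤1 c e c≤1 e≤1 j = newton≤½ (e j) (μ j) (proj₂ (minor^ t c e (μ j)))
    (subst (λ k → ∣ proj₂ (minor^ t c e (μ j)) -ℚ σ (μ j) *ℚ (η *ℚ e k) ∣ ≤ ½ *ℚ η) (μ-involutive j)
      (minor^-near₂ 0≤t t≤1 c e c≤1 e≤1 (μ j)))

  T≤½ : ∀ c → InBox c → ∀ j → ∣ T c j ∣ ≤ ½
  T≤½ c c≤1 j = newton≤½ (c j) (μ j) (minor c (μ j))
    (subst₂ (λ x k → ∣ x -ℚ σ (μ j) *ℚ (η *ℚ c k) ∣ ≤ ½ *ℚ η) (minor-eval-0 0ℚ c c (μ j)) (μ-involutive j)
      -- Only the first coordinate is read, and it is `minor c` for every step and direction; `0ℚ`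
      -- and `c` are just admissible choices.
      (≤-sumˡ _ (proj₂ (minor^ 0ℚ c c (μ j)) -ℚ σ (μ j) *ℚ (η *ℚ c (μ (μ j))))
        (minor^-near ℚₚ.≤-refl 0≤1 c c c≤1 c≤1 (μ j))))

  -- (cₖ , eₖ) with T cₖ = cₖ + 2⁻ᵏ eₖ = cₖ₊₁.
  iterate : ℕ → Vector ℚ (suc n) × Vector ℚ (suc n)
  iterate zero    = (λ _ → 0ℚ) , T (λ _ → 0ℚ)
  iterate (suc k) = let c , e = iterate k in
    c ⊕ half^ k ⊙ e , λ j → T^ (half^ k) c e j +ℚ T^ (half^ k) c e j

  approx : ℕ → Vector ℚ (suc n)
  approx k = proj₁ (iterate k)

  increment : ℕ → Vector ℚ (suc n)
  increment k = proj₂ (iterate k)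

  record Invariant (k : ℕ) : Set where
    field
      c-inBox : InBox (approx k)
      e-inBox : InBox (increment k)
      T-step  : ∀ j → T (approx k) j ≡ approx (suc k) j

  -- The iterates stay in the box because each is an image under `T`. The next increment is twice
  -- the difference quotient: the doubling makes up for the halved step, and the bound ½ on the
  -- quotient leaves the increment bounded by 1.
  invariant : ∀ k → Invariant k
  invariant zero = record
    { c-inBox = λ _ → 0≤1
    ; e-inBox = λ j → ℚₚ.≤-trans (T≤½ (λ _ → 0ℚ) (λ _ → 0≤1) j) ½≤1
    ; T-step  = λ j → sym (trans (ℚₚ.+-identityˡ (1ℚ *ℚ T (λ _ → 0ℚ) j)) (ℚₚ.*-identityˡ (T (λ _ → 0ℚ) j)))
    }
  invariant (suc k) = record
    { c-inBox = λ j → subst (λ z → ∣ z ∣ ≤ 1ℚ) (T-step j) (ℚₚ.≤-trans (T≤½ c c-inBox j) ½≤1)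
    ; e-inBox = λ j → ℚₚ.≤-trans (ℚₚ.∣p+q∣≤∣p∣+∣q∣ (e′ j) (e′ j)) (ℚₚ.+-mono-≤ {∣ e′ j ∣} {½} {∣ e′ j ∣} {½} (e′≤½ j) (e′≤½ j))
    ; T-step  = λ j → trans (T-difference t c e j) (cong₂ _+ℚ_ (T-step j)
        (solve 2 (λ t x → t :* x := (con ½ :* t) :* (x :+ x)) refl t (e′ j)))
    }
    where
    open Invariant (invariant k)
    t = half^ k
    c = approx k
    e = increment k
    e′ = T^ t c e
    e′≤½ : ∀ j → ∣ e′ j ∣ ≤ ½
    e′≤½ = T^≤½ (0≤half^ k) (half^≤1 k) c e c-inBox e-inBox

  scaled-increment : ∀ k j → ∣ half^ k *ℚ increment k j ∣ ≤ half^ k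
  scaled-increment k j = begin
    ∣ half^ k *ℚ increment k j ∣       ≡⟨ ℚₚ.∣p*q∣≡∣p∣*∣q∣ (half^ k) (increment k j) ⟩
    ∣ half^ k ∣ *ℚ ∣ increment k j ∣   ≡⟨ cong (_*ℚ ∣ increment k j ∣) (ℚₚ.0≤p⇒∣p∣≡p (0≤half^ k)) ⟩
    half^ k *ℚ ∣ increment k j ∣       ≤⟨ ℚₚ.*-monoˡ-≤-nonNeg (half^ k) {{nonNegative (0≤half^ k)}} (Invariant.e-inBox (invariant k) j) ⟩
    half^ k *ℚ 1ℚ                      ≡⟨ ℚₚ.*-identityʳ (half^ k) ⟩
    half^ k                            ∎
    where open ℚₚ.≤-Reasoning

  approx-step : ∀ k j → ∣ approx (suc k) j -ℚ approx k j ∣ ≤ half^ k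
  approx-step k j = subst (λ z → ∣ z ∣ ≤ half^ k)
    (solve 2 (λ c d → d := (c :+ d) :- c) refl (approx k j) (half^ k *ℚ increment k j)) (scaled-increment k j)

  -- Solving the Newton step for the minor gives - σ η (T c - c), and T c - c is 2⁻ᵏ times an
  -- increment in the box. This rate makes the minors of the limit vanish with no appeal to
  -- continuity of the determinant.
  minor-residual : ∀ k i → ∣ minor (approx k) i ∣ ≤ half^ k
  minor-residual k i = subst (λ l → ∣ minor (approx k) l ∣ ≤ half^ k) (μ-involutive i) (at (μ i))
    where
    at : ∀ j → ∣ minor (approx k) (μ j) ∣ ≤ half^ k
    at j = begin
      ∣ F ∣                       ≡⟨ cong ∣_∣ solved ⟩
      ∣ -ℚ (s *ℚ (η *ℚ d)) ∣      ≡⟨ ℚₚ.∣-p∣≡∣p∣ (s *ℚ (η *ℚ d)) ⟩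
      ∣ s *ℚ (η *ℚ d) ∣           ≡⟨ trans (ℚₚ.∣p*q∣≡∣p∣*∣q∣ s (η *ℚ d)) (cong (∣ s ∣ *ℚ_)
                                       (trans (ℚₚ.∣p*q∣≡∣p∣*∣q∣ η d) (cong (_*ℚ ∣ d ∣) (ℚₚ.0≤p⇒∣p∣≡p 0≤η)))) ⟩
      ∣ s ∣ *ℚ (η *ℚ ∣ d ∣)       ≤⟨ *-mono-≤ℚ (ℚₚ.0≤∣p∣ s) (*-nonNegℚ 0≤1 (0≤half^ k)) (∣σ∣≤1 (μ j))
                                       (*-mono-≤ℚ 0≤η (0≤half^ k) η≤1 (scaled-increment k j)) ⟩
      1ℚ *ℚ (1ℚ *ℚ half^ k)       ≡⟨ trans (ℚₚ.*-identityˡ _) (ℚₚ.*-identityˡ (half^ k)) ⟩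
      half^ k                     ∎
      where
      open ℚₚ.≤-Reasoning
      s = σ (μ j)
      F = minor (approx k) (μ j)
      d = half^ k *ℚ increment k j
      c = approx k j
      solved : F ≡ -ℚ (s *ℚ (η *ℚ d))
      solved = ≡.begin
        F                                                 ≡.≡⟨ sym (trans (cong (_*ℚ F) (cong₂ _*ℚ_ (σ*σ≡1 (μ j)) Hη≡1)) (ℚₚ.*-identityˡ F)) ⟩
        (s *ℚ s) *ℚ (H *ℚ η) *ℚ F                         ≡.≡⟨ solve 5 (λ s H η F c → (s :* s) :* (H :* η) :* F
                                                               := :- (s :* (η :* ((c :- (s :* H) :* F) :- c)))) refl s H η F c ⟩
        -ℚ (s *ℚ (η *ℚ (T (approx k) j -ℚ c)))            ≡.≡⟨ cong (λ z → -ℚ (s *ℚ (η *ℚ (z -ℚ c)))) (Invariant.T-step (invariant k) j) ⟩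
        -ℚ (s *ℚ (η *ℚ ((c +ℚ d) -ℚ c)))                  ≡.≡⟨ solve 4 (λ s η c d → :- (s :* (η :* ((c :+ d) :- c))) := :- (s :* (η :* d))) refl s η c d ⟩
        -ℚ (s *ℚ (η *ℚ d))                                ≡.∎
        where module ≡ = ≡-Reasoning

-- Cauchy sequences

toℚᵘ-fromℕ : ∀ n → toℚᵘ (fromℕ n) ℚᵘ.≃ ℚᵘ.mkℚᵘ (ℤ.+ n) 0
toℚᵘ-fromℕ zero    = ℚᵘₚ.≃-refl
toℚᵘ-fromℕ (suc n) = ℚᵘₚ.≃-trans (ℚₚ.toℚᵘ-homo-+ 1ℚ (fromℕ n))
  (ℚᵘₚ.≃-trans (ℚᵘₚ.+-congʳ ℚᵘ.1ℚᵘ (toℚᵘ-fromℕ n))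
    (ℚᵘ.*≡* (cong (ℤ._* ℤ.1ℤ) (cong (λ z → ℤ.1ℤ ℤ.+ z) (ℤₚ.*-identityʳ (ℤ.+ n))))))

archimedean : ∀ ε → 0ℚ < ε → ∃[ n ] (1ℚ ≤ fromℕ n *ℚ ε)
archimedean ε 0<ε = go ε (positive 0<ε)
  where
  open ℚᵘₚ.≤-Reasoning
  go : ∀ ε → Positive ε → ∃[ n ] (1ℚ ≤ fromℕ n *ℚ ε)
  -- Here ε = (a + 1) / (d + 1), and multiplying by the denominator leaves a + 1.
  go ε@(mkℚ ℤ.+[1+ a ] d _) _ = suc d , ℚₚ.toℚᵘ-cancel-≤ (begin
    ℚᵘ.1ℚᵘ                                             ≤⟨ ℚᵘ.*≤* (ℤ.+≤+ bound) ⟩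
    ℚᵘ.mkℚᵘ (ℤ.+ suc d) 0 ℚᵘ.* ℚᵘ.mkℚᵘ (ℤ.+ suc a) d    ≃⟨ ℚᵘₚ.*-congʳ {ℚᵘ.mkℚᵘ (ℤ.+ suc a) d} (toℚᵘ-fromℕ (suc d)) ⟨
    toℚᵘ (fromℕ (suc d)) ℚᵘ.* toℚᵘ ε                   ≃⟨ ℚₚ.toℚᵘ-homo-* (fromℕ (suc d)) ε ⟨
    toℚᵘ (fromℕ (suc d) *ℚ ε)                          ∎)
    where
    bound : suc (d +ℕ 0) +ℕ 0 ≤ℕ suc (a +ℕ d *ℕ suc a) *ℕ 1
    bound = subst₂ _≤ℕ_ (sym (trans (ℕₚ.+-identityʳ _) (cong suc (ℕₚ.+-identityʳ d))))
      (sym (ℕₚ.*-identityʳ _)) (ℕₚ.m≤m*n (suc d) (suc a))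
  go (mkℚ ℤ.+0 _ _) record { pos = () }
  go (mkℚ ℤ.-[1+ _ ] _ _) record { pos = () }

fromℕ*half^≤1 : ∀ n → fromℕ n *ℚ half^ n ≤ 1ℚ
fromℕ*half^≤1 zero    = 0≤1
fromℕ*half^≤1 (suc n) = begin
  (1ℚ +ℚ fromℕ n) *ℚ (½ *ℚ half^ n)            ≡⟨ solve 2 (λ m h → (con 1ℚ :+ m) :* (con ½ :* h) := con ½ :* h :+ con ½ :* (m :* h)) refl (fromℕ n) (half^ n) ⟩
  ½ *ℚ half^ n +ℚ ½ *ℚ (fromℕ n *ℚ half^ n)    ≤⟨ ℚₚ.+-mono-≤ (ℚₚ.*-monoˡ-≤-nonNeg ½ (half^≤1 n)) (ℚₚ.*-monoˡ-≤-nonNeg ½ (fromℕ*half^≤1 n)) ⟩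
  1ℚ                                           ∎
  where open ℚₚ.≤-Reasoning

fromℕ-pos : ∀ n {q} → 1ℚ ≤ fromℕ n *ℚ q → 0ℚ < fromℕ n
fromℕ-pos zero    {q} 1≤ = contradiction refl
  (ℚₚ.<⇒≢ (ℚₚ.<-≤-trans (ℚₚ.positive⁻¹ 1ℚ) (subst (1ℚ ≤_) (ℚₚ.*-zeroˡ q) 1≤)))
fromℕ-pos (suc n) _      = ℚₚ.+-mono-<-≤ {0ℚ} {1ℚ} {0ℚ} (ℚₚ.positive⁻¹ 1ℚ) (0≤fromℕ n)

-- From n 2⁻ⁿ ≤ 1 ≤ n (½ ε) one cancels n; halving ε beforehand makes the inequality strict.
half^-small : ∀ ε → 0ℚ < ε → ∃[ n ] (half^ n < ε)
half^-small ε 0<ε with archimedean (½ *ℚ ε) (half-pos ε 0<ε)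
... | n , 1≤ = n , ℚₚ.≤-<-trans h≤ ½ε<ε
  where
  open ℚₚ.≤-Reasoning
  h≤ : half^ n ≤ ½ *ℚ ε
  h≤ = ℚₚ.*-cancelˡ-≤-pos (fromℕ n) {{positive (fromℕ-pos n 1≤)}} (ℚₚ.≤-trans (fromℕ*half^≤1 n) 1≤)
  ½ε<ε : ½ *ℚ ε < ε
  ½ε<ε = subst₂ _<_ (ℚₚ.+-identityʳ (½ *ℚ ε)) (half+half ε) (ℚₚ.+-monoʳ-< (½ *ℚ ε) (half-pos ε 0<ε))

module _ {s : ℕ → ℚ} (step : ∀ k → ∣ s (suc k) -ℚ s k ∣ ≤ half^ k) where
  geometric-tail : ∀ d k → ∣ s (d +ℕ k) -ℚ s k ∣ ≤ half^ k +ℚ half^ k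
  geometric-tail zero    k = subst (λ z → ∣ z ∣ ≤ half^ k +ℚ half^ k) (sym (ℚₚ.+-inverseʳ (s k)))
    (+-nonNegℚ (0≤half^ k) (0≤half^ k))
  geometric-tail (suc d) k = begin
    ∣ s (suc (d +ℕ k)) -ℚ s k ∣
      ≡⟨ cong (λ m → ∣ s m -ℚ s k ∣) (ℕₚ.+-suc d k) ⟨
    ∣ s (d +ℕ suc k) -ℚ s k ∣
      ≡⟨ cong ∣_∣ (solve 3 (λ a b c → a :- c := (a :- b) :+ (b :- c)) refl (s (d +ℕ suc k)) (s (suc k)) (s k)) ⟩
    ∣ (s (d +ℕ suc k) -ℚ s (suc k)) +ℚ (s (suc k) -ℚ s k) ∣
      ≤⟨ ℚₚ.∣p+q∣≤∣p∣+∣q∣ (s (d +ℕ suc k) -ℚ s (suc k)) (s (suc k) -ℚ s k) ⟩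
    ∣ s (d +ℕ suc k) -ℚ s (suc k) ∣ +ℚ ∣ s (suc k) -ℚ s k ∣
      ≤⟨ ℚₚ.+-mono-≤ (geometric-tail d (suc k)) (step k) ⟩
    (½ *ℚ half^ k +ℚ ½ *ℚ half^ k) +ℚ half^ k
      ≡⟨ cong (_+ℚ half^ k) (half+half (half^ k)) ⟩
    half^ k +ℚ half^ k ∎
    where open ℚₚ.≤-Reasoning

  geometric⇒cauchy : IsCauchy s
  geometric⇒cauchy ε 0<ε with half^-small ε 0<ε
  ... | N , small = N₂ , λ m n h k → begin-strict
    ∣ s m -ℚ s n ∣
      ≡⟨ cong ∣_∣ (solve 3 (λ a b c → a :- b := (a :- c) :+ (:- (b :- c))) refl (s m) (s n) (s N₂)) ⟩
    ∣ (s m -ℚ s N₂) +ℚ (-ℚ (s n -ℚ s N₂)) ∣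
      ≤⟨ ℚₚ.∣p+q∣≤∣p∣+∣q∣ (s m -ℚ s N₂) (-ℚ (s n -ℚ s N₂)) ⟩
    ∣ s m -ℚ s N₂ ∣ +ℚ ∣ -ℚ (s n -ℚ s N₂) ∣
      ≡⟨ cong (∣ s m -ℚ s N₂ ∣ +ℚ_) (ℚₚ.∣-p∣≡∣p∣ (s n -ℚ s N₂)) ⟩
    ∣ s m -ℚ s N₂ ∣ +ℚ ∣ s n -ℚ s N₂ ∣
      ≤⟨ ℚₚ.+-mono-≤ (tail-≤ m h) (tail-≤ n k) ⟩
    (half^ N₂ +ℚ half^ N₂) +ℚ (half^ N₂ +ℚ half^ N₂)
      ≡⟨ solve 1 (λ h → let q = con ½ :* (con ½ :* h) in (q :+ q) :+ (q :+ q) := h) refl (half^ N) ⟩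
    half^ N
      <⟨ small ⟩
    ε ∎
    where
    open ℚₚ.≤-Reasoning
    -- Two tails starting at `N₂` cost four times `half^ N₂`, which is `half^ N`.
    N₂ = suc (suc N)
    tail-≤ : ∀ m → N₂ ≤ℕ m → ∣ s m -ℚ s N₂ ∣ ≤ half^ N₂ +ℚ half^ N₂
    tail-≤ m N₂≤m = subst (λ l → ∣ s l -ℚ s N₂ ∣ ≤ half^ N₂ +ℚ half^ N₂) (ℕₚ.m∸n+n≡m N₂≤m)
      (geometric-tail (m ∸ N₂) N₂)

half^-bounded⇒≃0 : ∀ x → (∀ k → ∣ seq x k ∣ ≤ half^ k) → x ≃ 0ℝ
half^-bounded⇒≃0 x x≤ ε 0<ε with half^-small ε 0<ε
... | N , small = N , λ k N≤k → ℚₚ.≤-<-trans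
  (ℚₚ.≤-trans (subst (λ z → ∣ z ∣ ≤ half^ k) (sym (ℚₚ.+-identityʳ (seq x k))) (x≤ k)) (half^-antitone N≤k))
  small

pointwise⇒≃ : ∀ x y → (∀ k → seq x k ≡ seq y k) → x ≃ y
pointwise⇒≃ x y eq ε 0<ε = 0 , λ k _ →
  subst (λ d → ∣ d ∣ < ε) (sym (trans (cong (_-ℚ seq y k) (eq k)) (ℚₚ.+-inverseʳ (seq y k)))) 0<ε

≃-sym : ∀ {x y} → x ≃ y → y ≃ x
≃-sym {x} {y} x≃y ε 0<ε with x≃y ε 0<ε
... | N , close = N , λ k N≤k → subst (_< ε)
  (trans (sym (ℚₚ.∣-p∣≡∣p∣ (seq x k -ℚ seq y k)))
    (cong ∣_∣ (solve 2 (λ a b → :- (a :- b) := b :- a) refl (seq x k) (seq y k))))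
  (close k N≤k)

-- Besides `0ℝ`, `x` may be a low coefficient of a multiple of a power of X, all of whose terms are
-- 0; this yields the non-divisibility results.
apart⇒≄ : ∀ {δ} x y → 0ℚ < δ → (∀ k → seq x k ≡ 0ℚ) → (∀ k → δ ≤ ∣ seq y k ∣) → x ≄ y
apart⇒≄ {δ} x y 0<δ x≡0 δ≤y x≃y with x≃y δ 0<δ
... | N , close = ℚₚ.<-irrefl refl (ℚₚ.≤-<-trans (δ≤y N) (subst (_< δ)
  (trans (cong (λ z → ∣ z -ℚ seq y N ∣) (x≡0 N))
    (trans (cong ∣_∣ (ℚₚ.+-identityˡ (-ℚ seq y N))) (ℚₚ.∣-p∣≡∣p∣ (seq y N))))
  (close N ℕₚ.≤-refl)))

-- Polynomials over ℝ

seq-hom : ℕ → StrictHom ℝ-rawRing ℚ-rawRing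
seq-hom k = record
  { ⟦_⟧ = λ x → seq x k
  ; +-hom = λ _ _ → refl
  ; *-hom = λ _ _ → refl
  ; neg-hom = λ _ → refl
  ; 0#-hom = refl
  ; 1#-hom = refl
  }

ℝ[X] : RawRing 0ℓ 0ℓ
ℝ[X] = polyRawRing ℝ-rawRing

module _ (k : ℕ) where
  coeffAt : Poly ℝ-rawRing → ℕ → ℚ
  coeffAt p n = seq (coeff ℝ-rawRing p n) k

  coeffAt-add : ∀ p q n → coeffAt (addPoly ℝ-rawRing p q) n ≡ coeffAt p n +ℚ coeffAt q n
  coeffAt-add []      q       n       = sym (ℚₚ.+-identityˡ (coeffAt q n))
  coeffAt-add (a ∷ p) []      n       = sym (ℚₚ.+-identityʳ (coeffAt (a ∷ p) n))
  coeffAt-add (a ∷ p) (b ∷ q) zero    = refl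
  coeffAt-add (a ∷ p) (b ∷ q) (suc n) = coeffAt-add p q n

  coeffAt-scale : ∀ a p n → coeffAt (map (a *ℝ_) p) n ≡ seq a k *ℚ coeffAt p n
  coeffAt-scale a []      n       = sym (ℚₚ.*-zeroʳ (seq a k))
  coeffAt-scale a (b ∷ p) zero    = refl
  coeffAt-scale a (b ∷ p) (suc n) = coeffAt-scale a p n

  coeffAt-neg : ∀ p n → coeffAt (map -ℝ_ p) n ≡ -ℚ coeffAt p n
  coeffAt-neg []      n       = refl
  coeffAt-neg (b ∷ p) zero    = refl
  coeffAt-neg (b ∷ p) (suc n) = coeffAt-neg p n

  coeffAt-mul : ∀ a p q n → coeffAt (mulPoly ℝ-rawRing (a ∷ p) q) n
    ≡ seq a k *ℚ coeffAt q n +ℚ coeffAt (0ℝ ∷ mulPoly ℝ-rawRing p q) n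
  coeffAt-mul a p q n = trans (coeffAt-add (map (a *ℝ_) q) (0ℝ ∷ mulPoly ℝ-rawRing p q) n)
    (cong (_+ℚ coeffAt (0ℝ ∷ mulPoly ℝ-rawRing p q) n) (coeffAt-scale a q n))

  coeffAt-mul₀ : ∀ p q → coeffAt (mulPoly ℝ-rawRing p q) 0 ≡ coeffAt p 0 *ℚ coeffAt q 0
  coeffAt-mul₀ []      q = sym (ℚₚ.*-zeroˡ (coeffAt q 0))
  coeffAt-mul₀ (a ∷ p) q = trans (coeffAt-mul a p q 0) (ℚₚ.+-identityʳ (seq a k *ℚ coeffAt q 0))

  coeffAt-mul₁ : ∀ p q → coeffAt (mulPoly ℝ-rawRing p q) 1 ≡ coeffAt p 0 *ℚ coeffAt q 1 +ℚ coeffAt p 1 *ℚ coeffAt q 0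
  coeffAt-mul₁ []      q = solve 2 (λ a b → con 0ℚ := con 0ℚ :* a :+ con 0ℚ :* b) refl (coeffAt q 1) (coeffAt q 0)
  coeffAt-mul₁ (a ∷ p) q = trans (coeffAt-mul a p q 1) (cong (seq a k *ℚ coeffAt q 1 +ℚ_) (coeffAt-mul₀ p q))

  -- Truncation mod X², followed by X ↦ h x.
  truncate-hom : ℚ → StrictHom ℝ[X] (D 0ℚ)
  truncate-hom h = record
    { ⟦_⟧ = λ p → coeffAt p 0 , h *ℚ coeffAt p 1
    ; +-hom = λ p q → cong₂ _,_ (coeffAt-add p q 0)
        (trans (cong (h *ℚ_) (coeffAt-add p q 1)) (ℚₚ.*-distribˡ-+ h (coeffAt p 1) (coeffAt q 1)))
    ; *-hom = λ p q → cong₂ _,_ (coeffAt-mul₀ p q) (trans (cong (h *ℚ_) (coeffAt-mul₁ p q))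
        (solve 5 (λ h p₀ p₁ q₀ q₁ → h :* (p₀ :* q₁ :+ p₁ :* q₀)
          := p₀ :* (h :* q₁) :+ (h :* p₁) :* q₀ :+ con 0ℚ :* ((h :* p₁) :* (h :* q₁)))
          refl h (coeffAt p 0) (coeffAt p 1) (coeffAt q 0) (coeffAt q 1)))
    ; neg-hom = λ p → cong₂ _,_ (coeffAt-neg p 0) (trans (cong (h *ℚ_) (coeffAt-neg p 1))
        (sym (ℚₚ.neg-distribʳ-* h (coeffAt p 1))))
    ; 0#-hom = cong (0ℚ ,_) (ℚₚ.*-zeroʳ h)
    ; 1#-hom = cong (1ℚ ,_) (ℚₚ.*-zeroʳ h)
    }

open RawSemiringDefs (RawRing.rawSemiring ℝ[X]) using (_^_; _∣_; _∤_)

X : Poly ℝ-rawRing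
X = X-_ ℝ-rawRing 0ℝ

coeffAt-mul-1 : ∀ k p n → coeffAt k (mulPoly ℝ-rawRing p (1ℝ ∷ [])) n ≡ coeffAt k p n
coeffAt-mul-1 k []      n       = refl
coeffAt-mul-1 k (a ∷ p) zero    = trans (coeffAt-mul₀ k (a ∷ p) (1ℝ ∷ [])) (ℚₚ.*-identityʳ (seq a k))
coeffAt-mul-1 k (a ∷ p) (suc n) = trans (coeffAt-mul k a p (1ℝ ∷ []) (suc n))
  (trans (cong (_+ℚ coeffAt k (mulPoly ℝ-rawRing p (1ℝ ∷ [])) n) (ℚₚ.*-zeroʳ (seq a k)))
    (trans (ℚₚ.+-identityˡ (coeffAt k (mulPoly ℝ-rawRing p (1ℝ ∷ [])) n)) (coeffAt-mul-1 k p n)))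

coeffAt-mul-X : ∀ k p n → coeffAt k (mulPoly ℝ-rawRing p (X ^ 1)) (suc n) ≡ coeffAt k p n
coeffAt-mul-X k []      n = refl
coeffAt-mul-X k (a ∷ p) n = trans (coeffAt-mul k a p (X ^ 1) (suc n)) (rest n)
  where
  rest : ∀ n → seq a k *ℚ coeffAt k (X ^ 1) (suc n) +ℚ coeffAt k (mulPoly ℝ-rawRing p (X ^ 1)) n ≡ coeffAt k (a ∷ p) n
  rest zero    = trans (cong (seq a k *ℚ 1ℚ +ℚ_) (trans (coeffAt-mul₀ k p (X ^ 1)) (ℚₚ.*-zeroʳ (coeffAt k p 0))))
    (solve 1 (λ a → a :* con 1ℚ :+ con 0ℚ := a) refl (seq a k))
  rest (suc n) = trans (cong₂ _+ℚ_ (ℚₚ.*-zeroʳ (seq a k)) (coeffAt-mul-X k p n)) (ℚₚ.+-identityˡ (coeffAt k p n))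

coeff-drop : ∀ p n → coeff ℝ-rawRing (drop 1 p) n ≡ coeff ℝ-rawRing p (suc n)
coeff-drop []      n = refl
coeff-drop (a ∷ p) n = refl

X∤ : ∀ {δ} p → 0ℚ < δ → (∀ k → δ ≤ ∣ coeffAt k p 0 ∣) → X ^ 1 ∤ p
X∤ p 0<δ δ≤ record { quotient = q ; equality = eq } = apart⇒≄ (coeff ℝ-rawRing (mulPoly ℝ-rawRing q (X ^ 1)) 0) (coeff ℝ-rawRing p 0) 0<δ
  (λ k → trans (coeffAt-mul₀ k q (X ^ 1)) (ℚₚ.*-zeroʳ (coeffAt k q 0))) δ≤ (eq 0)

X²∤ : ∀ {δ} p → 0ℚ < δ → (∀ k → δ ≤ ∣ coeffAt k p 1 ∣) → X ^ 2 ∤ p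
X²∤ p 0<δ δ≤ record { quotient = q ; equality = eq } = apart⇒≄ (coeff ℝ-rawRing (mulPoly ℝ-rawRing q (X ^ 2)) 1) (coeff ℝ-rawRing p 1) 0<δ
  (λ k → trans (coeffAt-mul₁ k q (X ^ 2))
    (solve 2 (λ a b → a :* con 0ℚ :+ b :* con 0ℚ := con 0ℚ) refl (coeffAt k q 0) (coeffAt k q 1))) δ≤ (eq 1)

X⁰∣ : ∀ p → X ^ 0 ∣ p
X⁰∣ p = record { quotient = p ; equality = λ n → pointwise⇒≃ (coeff ℝ-rawRing (mulPoly ℝ-rawRing p (X ^ 0)) n) (coeff ℝ-rawRing p n) λ k → coeffAt-mul-1 k p n }

-- Dropping the constant term and multiplying by X puts an exact 0 in its place; all other
-- coefficients return termwise unchanged.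
X∣ : ∀ p → coeff ℝ-rawRing p 0 ≃ 0ℝ → X ^ 1 ∣ p
X∣ p p₀≃0 = record { quotient = drop 1 p ; equality = equality }
  where
  equality : ∀ n → coeff ℝ-rawRing (mulPoly ℝ-rawRing (drop 1 p) (X ^ 1)) n ≃ coeff ℝ-rawRing p n
  equality zero ε 0<ε with p₀≃0 ε 0<ε
  ... | N , close = N , λ k N≤k → subst (_< ε) (trans
    (sym (ℚₚ.∣-p∣≡∣p∣ (coeffAt k p 0 -ℚ 0ℚ)))
    (cong ∣_∣ (trans (solve 1 (λ a → :- (a :- con 0ℚ) := con 0ℚ :- a) refl (coeffAt k p 0))
      (cong (_-ℚ coeffAt k p 0) (sym (trans (coeffAt-mul₀ k (drop 1 p) (X ^ 1)) (ℚₚ.*-zeroʳ (coeffAt k (drop 1 p) 0))))))))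
    (close k N≤k)
  equality (suc n) = pointwise⇒≃ (coeff ℝ-rawRing (mulPoly ℝ-rawRing (drop 1 p) (X ^ 1)) (suc n)) (coeff ℝ-rawRing p (suc n)) λ k →
    trans (coeffAt-mul-X k (drop 1 p) n) (cong (λ x → seq x k) (coeff-drop p n))

-- Lower bounds on determinants

-- Substituting h x for X turns X I into the direction h I of a matrix over the dual numbers. The
-- scale h = η matches the diagonal η e of `B̂`, and h = 0 isolates the constant coefficient.
charPoly-truncated : ∀ {m} k h (M : Matrix ℝ m) (N : Matrix (ℚ × ℚ) m) →
  (∀ i → N i i ≡ (-ℚ seq (M i i) k , h)) → (∀ i j → i ≢ j → N i j ≡ (-ℚ seq (M i j) k , 0ℚ)) →
  (coeffAt k (charPoly ℝ-rawRing M) 0 , h *ℚ coeffAt k (charPoly ℝ-rawRing M) 1) ≡ det (D 0ℚ) N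
charPoly-truncated k h M N diagonal off-diagonal = StrictHom.det-hom (truncate-hom k h) entries
  where
  entry : ∀ i j → Poly ℝ-rawRing
  entry i j = if does (i ≟ᶠ j) then (X-_) ℝ-rawRing (M i j) else -ℝ M i j ∷ []
  entries : ∀ i j → (coeffAt k (entry i j) 0 , h *ℚ coeffAt k (entry i j) 1) ≡ N i j
  entries i j with i ≟ᶠ j
  ... | yes refl = trans (cong (-ℚ seq (M i i) k ,_) (ℚₚ.*-identityʳ h)) (sym (diagonal i))
  ... | no i≢j   = trans (cong (-ℚ seq (M i j) k ,_) (ℚₚ.*-zeroʳ h)) (sym (off-diagonal i j i≢j))

reverse-triangle : ∀ {δ ε} x y → δ +ℚ ε ≤ ∣ y ∣ → ∣ x -ℚ y ∣ ≤ ε → δ ≤ ∣ x ∣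
reverse-triangle {δ} {ε} x y δ+ε≤y x-y≤ε = subst₂ _≤_ (cancel δ ε) (cancel (∣ x ∣) ε) (ℚₚ.+-monoˡ-≤ (-ℚ ε) (begin
  δ +ℚ ε                        ≤⟨ δ+ε≤y ⟩
  ∣ y ∣                         ≡⟨ cong ∣_∣ (solve 2 (λ x y → y := x :+ (:- (x :- y))) refl x y) ⟩
  ∣ x +ℚ (-ℚ (x -ℚ y)) ∣        ≤⟨ ℚₚ.∣p+q∣≤∣p∣+∣q∣ x (-ℚ (x -ℚ y)) ⟩
  ∣ x ∣ +ℚ ∣ -ℚ (x -ℚ y) ∣      ≡⟨ cong (∣ x ∣ +ℚ_) (ℚₚ.∣-p∣≡∣p∣ (x -ℚ y)) ⟩
  ∣ x ∣ +ℚ ∣ x -ℚ y ∣           ≤⟨ ℚₚ.+-monoʳ-≤ (∣ x ∣) x-y≤ε ⟩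
  ∣ x ∣ +ℚ ε                    ∎))
  where
  open ℚₚ.≤-Reasoning
  cancel : ∀ p q → (p +ℚ q) +ℚ (-ℚ q) ≡ p
  cancel = solve 2 (λ p q → (p :+ q) :+ (:- q) := p) refl

∣product∣≡1 : ∀ {n} (f : Vector ℚ n) → (∀ i → ∣ f i ∣ ≡ 1ℚ) → ∣ productℚ f ∣ ≡ 1ℚ
∣product∣≡1 {zero}  f f≡1 = refl
∣product∣≡1 {suc n} f f≡1 = trans (ℚₚ.∣p*q∣≡∣p∣*∣q∣ (f fzero) (productℚ (f ∘ fsuc)))
  (cong₂ _*ℚ_ (f≡1 fzero) (∣product∣≡1 (f ∘ fsuc) (f≡1 ∘ fsuc)))

∣sgn∣≡1 : ∀ {n} (π : Permutation′ n) → ∣ sgn ℚ-rawRing π ∣ ≡ 1ℚ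
∣sgn∣≡1 π = ℚₚ.≤-antisym s≤1 (begin
  1ℚ                  ≡⟨ cong ∣_∣ (DetProperties.sgn*sgn≈1 ℚ-commutativeRing π) ⟨
  ∣ s *ℚ s ∣          ≡⟨ ℚₚ.∣p*q∣≡∣p∣*∣q∣ s s ⟩
  ∣ s ∣ *ℚ ∣ s ∣      ≤⟨ ℚₚ.*-monoˡ-≤-nonNeg (∣ s ∣) {{ℚₚ.∣-∣-nonNeg s}} s≤1 ⟩
  ∣ s ∣ *ℚ 1ℚ         ≡⟨ ℚₚ.*-identityʳ (∣ s ∣) ⟩
  ∣ s ∣               ∎)
  where
  open ℚₚ.≤-Reasoning
  s = sgn ℚ-rawRing π
  s≤1 = Perturbation.∥sgn∥≤1 ℚ-norm π

det-apart : ∀ {n δ} → 0ℚ ≤ δ → δ ≤ 1ℚ → (fromℕ n *ℚ δ) *ℚ factorial n ≤ ½ → (π : Permutation′ n) (P : Matrix ℚ n) →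
  (∀ k → ∣ P k (π ⟨$⟩ʳ k) ∣ ≡ 1ℚ) → (∀ k c → c ≢ π ⟨$⟩ʳ k → ∣ P k c ∣ ≤ δ) → ½ ≤ ∣ det ℚ-rawRing P ∣
det-apart {n} {δ} 0≤δ δ≤1 small π P P≡1 P≤δ = reverse-triangle (det ℚ-rawRing P) y (ℚₚ.≤-reflexive (sym ∣y∣≡1))
  (ℚₚ.≤-trans
    -- The index `n` lies beyond the last row, so no row is exceptional.
    (Perturbation.det-near-monomial ℚ-norm 0≤δ (λ _ → 1ℚ) π n P P≤1
      λ k c _ c≢ → subst (∣ P k c ∣ ≤_) (sym (ℚₚ.*-identityʳ δ)) (P≤δ k c c≢))
    (subst (λ z → (fromℕ n *ℚ δ) *ℚ z ≤ ½)
      (sym (trans (cong (factorial n *ℚ_) product-1) (ℚₚ.*-identityʳ (factorial n)))) small))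
  where
  y = sgn ℚ-rawRing π *ℚ productℚ (λ k → P k (π ⟨$⟩ʳ k))
  product-1 : productℚ {n} (λ _ → 1ℚ) ≡ 1ℚ
  product-1 = sum-zero (CommutativeRing.*-commutativeMonoid ℚ-commutativeRing) {n} (λ _ → 1ℚ) λ _ → refl
  ∣y∣≡1 : ∣ y ∣ ≡ 1ℚ
  ∣y∣≡1 = trans (ℚₚ.∣p*q∣≡∣p∣*∣q∣ (sgn ℚ-rawRing π) (productℚ λ k → P k (π ⟨$⟩ʳ k)))
    (cong₂ _*ℚ_ (∣sgn∣≡1 π) (∣product∣≡1 _ P≡1))
  P≤1 : ∀ k c → ∣ P k c ∣ ≤ 1ℚ
  P≤1 k c with c ≟ᶠ π ⟨$⟩ʳ k
  ... | yes refl = ℚₚ.≤-reflexive (P≡1 k)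
  ... | no c≢    = ℚₚ.≤-trans (P≤δ k c c≢) δ≤1

-- The choice of η

K : ℕ → ℚ
K n = fromℕ n *ℚ factorial n

0≤K : ∀ n → 0ℚ ≤ K n
0≤K n = *-nonNegℚ (0≤fromℕ n) (0≤factorial n)

⅛ : ℚ
⅛ = ½ *ℚ (½ *ℚ ½)

8ℚ : ℚ
8ℚ = fromℕ 8

record SmallWeight (n : ℕ) : Set where
  field
    η H     : ℚ
    0<η     : 0ℚ < η
    0≤H     : 0ℚ ≤ H
    Hη≡1    : H *ℚ η ≡ 1ℚ
    2η≤1    : η +ℚ η ≤ 1ℚ
    minors  : (fromℕ n *ℚ (η +ℚ η)) *ℚ (factorial n *ℚ (η +ℚ η)) ≤ ½ *ℚ η
    full    : (fromℕ (suc n) *ℚ η) *ℚ factorial (suc n) ≤ ½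

  0≤η : 0ℚ ≤ η
  0≤η = ℚₚ.<⇒≤ 0<η

  η≤1 : η ≤ 1ℚ
  η≤1 = ℚₚ.≤-trans (subst (_≤ η +ℚ η) (ℚₚ.+-identityʳ η) (ℚₚ.+-monoʳ-≤ η 0≤η)) 2η≤1

private module _ (n : ℕ) where
  -- `K n` is the constant n n! of the determinant estimate. With C η = ⅛ each of η, `K n` η and
  -- `K (suc n)` η is at most ⅛: the minors have error 4 (K n) η², so ⅛ brings it down to ½ η, and 8
  -- C is the inverse of η.
  C : ℚ
  C = 1ℚ +ℚ (K n +ℚ K (suc n))

  0<C : 0ℚ < C
  0<C = ℚₚ.+-mono-<-≤ {0ℚ} {1ℚ} {0ℚ} (ℚₚ.positive⁻¹ 1ℚ) (+-nonNegℚ (0≤K n) (0≤K (suc n)))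

module _ (n : ℕ) {η} (0<η : 0ℚ < η) (Cη≡⅛ : C n *ℚ η ≡ ⅛) where
  private
    open ℚₚ.≤-Reasoning
    0≤η : 0ℚ ≤ η
    0≤η = ℚₚ.<⇒≤ 0<η
    scaled : ∀ {q} → q ≤ C n → q *ℚ η ≤ ⅛
    scaled {q} q≤C = subst (q *ℚ η ≤_) Cη≡⅛ (ℚₚ.*-monoʳ-≤-nonNeg η {{nonNegative 0≤η}} q≤C)
    1≤C : 1ℚ ≤ C n
    1≤C = subst (_≤ C n) (ℚₚ.+-identityʳ 1ℚ) (ℚₚ.+-monoʳ-≤ 1ℚ (+-nonNegℚ (0≤K n) (0≤K (suc n))))
    Kn≤C : K n ≤ C n
    Kn≤C = subst (_≤ C n) (solve 1 (λ a → con 0ℚ :+ (a :+ con 0ℚ) := a) refl (K n))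
      (ℚₚ.+-mono-≤ 0≤1 (ℚₚ.+-monoʳ-≤ (K n) (0≤K (suc n))))
    Ksn≤C : K (suc n) ≤ C n
    Ksn≤C = subst (_≤ C n) (solve 1 (λ a → con 0ℚ :+ (con 0ℚ :+ a) := a) refl (K (suc n)))
      (ℚₚ.+-mono-≤ 0≤1 (ℚₚ.+-monoˡ-≤ (K (suc n)) (0≤K n)))
    Kη≤⅛ : K n *ℚ η ≤ ⅛
    Kη≤⅛ = scaled Kn≤C
    η≤⅛ : η ≤ ⅛
    η≤⅛ = subst (_≤ ⅛) (ℚₚ.*-identityˡ η) (scaled 1≤C)

  smallWeight′ : SmallWeight n
  smallWeight′ = record
    { η = η
    ; H = 8ℚ *ℚ C n
    ; 0<η = 0<η
    ; 0≤H = *-nonNegℚ (0≤fromℕ 8) (ℚₚ.<⇒≤ (0<C n))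
    ; Hη≡1 = trans (ℚₚ.*-assoc 8ℚ (C n) η) (cong (8ℚ *ℚ_) Cη≡⅛)
    ; 2η≤1 = ℚₚ.≤-trans (ℚₚ.+-mono-≤ η≤⅛ η≤⅛) (toWitness {a? = (⅛ +ℚ ⅛) ℚₚ.≤? 1ℚ} _)
    ; minors = begin
      (fromℕ n *ℚ (η +ℚ η)) *ℚ (factorial n *ℚ (η +ℚ η))
        ≡⟨ solve 3 (λ m f η → (m :* (η :+ η)) :* (f :* (η :+ η)) := ((m :* f :* η :+ m :* f :* η) :+ (m :* f :* η :+ m :* f :* η)) :* η) refl (fromℕ n) (factorial n) η ⟩
      ((K n *ℚ η +ℚ K n *ℚ η) +ℚ (K n *ℚ η +ℚ K n *ℚ η)) *ℚ η
        ≤⟨ ℚₚ.*-monoʳ-≤-nonNeg η {{nonNegative 0≤η}} (ℚₚ.+-mono-≤ (ℚₚ.+-mono-≤ Kη≤⅛ Kη≤⅛) (ℚₚ.+-mono-≤ Kη≤⅛ Kη≤⅛)) ⟩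
      ½ *ℚ η ∎
    ; full = begin
      (fromℕ (suc n) *ℚ η) *ℚ factorial (suc n)
        ≡⟨ solve 3 (λ m f η → (m :* η) :* f := (m :* f) :* η) refl (fromℕ (suc n)) (factorial (suc n)) η ⟩
      K (suc n) *ℚ η
        ≤⟨ scaled Ksn≤C ⟩
      ⅛
        ≤⟨ toWitness {a? = ⅛ ℚₚ.≤? ½} _ ⟩
      ½ ∎
    }

smallWeight : ∀ n → SmallWeight n
smallWeight n = let η , 0<η , Cη≡⅛ = quotient (C n) ⅛ (0<C n) (ℚₚ.positive⁻¹ ⅛) in smallWeight′ n 0<η Cη≡⅛

-- The real matrix and its multiplicities

module Construction {n} (w : SmallWeight n) (G : Graph (suc n)) (matching : PerfectMatching G) where
  open Graph G
  open PerfectMatching matching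
  open SmallWeight w

  ∣η∣≡η : ∣ η ∣ ≡ η
  ∣η∣≡η = ℚₚ.0≤p⇒∣p∣≡p 0≤η

  μ : Fin (suc n) → Fin (suc n)
  μ i = proj₁ (covered i)

  M-μ : ∀ i → i M μ i
  M-μ i = proj₁ (proj₂ (covered i))

  μ-unique : ∀ {i j} → i M j → μ i ≡ j
  μ-unique {i} = proj₂ (proj₂ (covered i))

  μ-involutive : ∀ i → μ (μ i) ≡ i
  μ-involutive i = μ-unique (M-sym (M-μ i))

  ~-μ : ∀ i → i ~ μ i
  ~-μ i = M⊆E (M-μ i)

  i≢μi : ∀ i → i ≢ μ i
  i≢μi i eq = ~-irr eq (~-μ i)

  W : Matrix ℚ (suc n)
  W i j = if does (μ i ≟ᶠ j) then 1ℚ else if does (i ~? j) then η else 0ℚ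

  W-μ : ∀ i → W i (μ i) ≡ 1ℚ
  W-μ i with μ i ≟ᶠ μ i
  ... | yes _ = refl
  ... | no ¬p = contradiction refl ¬p

  W≤η : ∀ i j → j ≢ μ i → ∣ W i j ∣ ≤ η
  W≤η i j j≢ with μ i ≟ᶠ j | i ~? j
  ... | yes p | _     = contradiction (sym p) j≢
  ... | no _  | yes _ = ℚₚ.≤-reflexive ∣η∣≡η
  ... | no _  | no _  = 0≤η

  W-edge : ∀ {i j} → i ~ j → η ≤ ∣ W i j ∣
  W-edge {i} {j} i~j with μ i ≟ᶠ j | i ~? j
  ... | yes _ | _      = η≤1
  ... | no _  | yes _  = ℚₚ.≤-reflexive (sym ∣η∣≡η)
  ... | no _  | no ¬ij = contradiction i~j ¬ij

  W-nonedge : ∀ {i j} → ¬ (i ~ j) → W i j ≡ 0ℚ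
  W-nonedge {i} {j} i≁j with μ i ≟ᶠ j | i ~? j
  ... | yes refl | _     = contradiction (~-μ i) i≁j
  ... | no _     | yes p = contradiction p i≁j
  ... | no _     | no _  = refl

  W-sym : ∀ i j → W i j ≡ W j i
  W-sym i j with μ i ≟ᶠ j | μ j ≟ᶠ i | i ~? j | j ~? i
  ... | yes _ | yes _ | _     | _     = refl
  ... | yes p | no ¬q | _     | _     = contradiction (trans (cong μ (sym p)) (μ-involutive i)) ¬q
  ... | no ¬p | yes q | _     | _     = contradiction (trans (cong μ (sym q)) (μ-involutive j)) ¬p
  ... | no _  | no _  | yes _ | yes _ = refl
  ... | no _  | no _  | yes p | no ¬q = contradiction (~-sym p) ¬q
  ... | no _  | no _  | no ¬p | yes q = contradiction (~-sym q) ¬p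
  ... | no _  | no _  | no _  | no _  = refl

  open Fixpoint μ μ-involutive i≢μi W W-μ η H 0≤η η≤1 0≤H Hη≡1 W≤η 2η≤1 minors

  diagonal : Vector ℝ (suc n)
  diagonal i = mkℝ (λ k → approx k i) (geometric⇒cauchy {λ k → approx k i} (λ k → approx-step k i))

  A : Matrix ℝ (suc n)
  A i j = -ℝ withDiagonal (λ i → fromℚ η *ℝ diagonal i) (λ i j → fromℚ (W i j)) i j

  -- This exact description of the terms carries the rational bounds, uniform in `k`, over to the
  -- real matrix.
  seq-A : ∀ k i j → seq (A i j) k ≡ -ℚ B (approx k) i j
  seq-A k i j = cong -ℚ_ (withDiagonal-map (λ x → seq x k) (λ i → fromℚ η *ℝ diagonal i) (λ i j → fromℚ (W i j)) i j)

  B-sym : ∀ c i j → B c i j ≡ B c j i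
  B-sym c i j with i ≟ᶠ j | j ≟ᶠ i
  ... | yes refl | yes _ = refl
  ... | yes p    | no ¬q = contradiction (sym p) ¬q
  ... | no ¬p    | yes q = contradiction (sym q) ¬p
  ... | no _     | no _  = W-sym i j

  B-off : ∀ c {i j} → i ≢ j → B c i j ≡ W i j
  B-off c {i} {j} i≢j with i ≟ᶠ j
  ... | yes p = contradiction p i≢j
  ... | no _  = refl

  seq-A-off : ∀ k {i j} → i ≢ j → seq (A i j) k ≡ -ℚ W i j
  seq-A-off k {i} {j} i≢j = trans (seq-A k i j) (cong -ℚ_ (B-off (approx k) i≢j))

  A∈S : A ∈S G
  A∈S = record
    { symmetric = λ i j → pointwise⇒≃ (A i j) (A j i) λ k →
        trans (seq-A k i j) (trans (cong -ℚ_ (B-sym (approx k) i j)) (sym (seq-A k j i)))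
    ; support = λ i j → mk⇔ (nonzero⇒edge i j) (edge⇒nonzero i j)
    }
    where
    nonzero⇒edge : ∀ i j → Support A i j → i ~ j
    -- `≄` is only a negation, so the edge is recovered through decidability of adjacency.
    nonzero⇒edge i j (i≢j , A≄0) = decidable-stable (i ~? j) λ i≁j →
      A≄0 (pointwise⇒≃ (A i j) 0ℝ λ k → trans (seq-A-off k i≢j) (cong -ℚ_ (W-nonedge i≁j)))
    edge⇒nonzero : ∀ i j → i ~ j → Support A i j
    edge⇒nonzero i j i~j = i≢j , λ A≃0 →
      apart⇒≄ 0ℝ (A i j) 0<η (λ _ → refl)
        (λ k → subst (η ≤_) (sym (trans (cong ∣_∣ (seq-A-off k i≢j)) (ℚₚ.∣-p∣≡∣p∣ (W i j)))) (W-edge i~j))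
        (≃-sym {A i j} {0ℝ} A≃0)
      where
      i≢j : i ≢ j
      i≢j eq = ~-irr eq i~j

  0<½ : 0ℚ < ½
  0<½ = ℚₚ.positive⁻¹ ½

  B-μ : ∀ c i → B c i (μ i) ≡ 1ℚ
  B-μ c i = trans (B-off c (i≢μi i)) (W-μ i)

  B≤η : ∀ {c} → InBox c → ∀ i j → j ≢ μ i → ∣ B c i j ∣ ≤ η
  B≤η {c} c≤1 i j j≢ with i ≟ᶠ j
  ... | yes _ = ∣ηq∣≤η (c i) (c≤1 i)
  ... | no _  = W≤η i j j≢

  -- Only absolute values of the entries matter, so it applies to `-B`, for the determinant of `A`,
  -- and to `B`, for the constant coefficient of its characteristic polynomial.
  det-apart-B : ∀ k (P : Matrix ℚ (suc n)) → (∀ i j → ∣ P i j ∣ ≡ ∣ B (approx k) i j ∣) → ½ ≤ ∣ det ℚ-rawRing P ∣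
  det-apart-B k P P≡B = det-apart 0≤η η≤1 full μ-permutation P
    (λ i → trans (P≡B i (μ i)) (cong ∣_∣ (B-μ (approx k) i)))
    (λ i j j≢ → subst (_≤ η) (sym (P≡B i j)) (B≤η (Invariant.c-inBox (invariant k)) i j j≢))

  nonsingular : NonSingular A
  nonsingular detA≃0 = apart⇒≄ 0ℝ (det ℝ-rawRing A) 0<½ (λ _ → refl)
    (λ k → subst (λ z → ½ ≤ ∣ z ∣) (sym (StrictHom.det-hom (seq-hom k) {A = A} λ i j → seq-A k i j))
      (det-apart-B k (λ i j → -ℚ B (approx k) i j) λ i j → ℚₚ.∣-p∣≡∣p∣ (B (approx k) i j)))
    (≃-sym {det ℝ-rawRing A} {0ℝ} detA≃0)

  -seq-A : ∀ k i j → B (approx k) i j ≡ -ℚ seq (A i j) k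
  -seq-A k i j = sym (trans (cong -ℚ_ (seq-A k i j)) (neg-involutive (B (approx k) i j)))
    where
    neg-involutive : ∀ q → -ℚ (-ℚ q) ≡ q
    neg-involutive = solve 1 (λ q → :- (:- q) := q) refl

  constant-coefficient : ∀ k → coeffAt k (charPoly ℝ-rawRing A) 0 ≡ det ℚ-rawRing (B (approx k))
  constant-coefficient k = trans
    (cong proj₁ (charPoly-truncated k 0ℚ A (λ i j → B (approx k) i j , 0ℚ)
      (λ i → cong (_, 0ℚ) (-seq-A k i i)) (λ i j _ → cong (_, 0ℚ) (-seq-A k i j))))
    (StrictHom.det-hom (eval-0 0ℚ) {A = λ i j → B (approx k) i j , 0ℚ} λ _ _ → refl)

  A-multiplicity : HasMultiplicity A 0ℝ 0
  A-multiplicity = X⁰∣ (charPoly ℝ-rawRing A) , X∤ (charPoly ℝ-rawRing A) 0<½ λ k →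
    subst (λ z → ½ ≤ ∣ z ∣) (sym (constant-coefficient k)) (det-apart-B k (B (approx k)) λ _ _ → refl)

  module _ (i : Fin (suc n)) where
    private
      χ : Poly ℝ-rawRing
      χ = charPoly ℝ-rawRing (deleteAt A i)

      1⃗ : Vector ℚ (suc n)
      1⃗ _ = 1ℚ

    -- The derivative of minor i in the direction of the identity matrix is the linear coefficient of χ.
    χ-truncated : ∀ k → (coeffAt k χ 0 , η *ℚ coeffAt k χ 1) ≡ minor^ 0ℚ (approx k) 1⃗ i
    χ-truncated k = charPoly-truncated k η (deleteAt A i) (deleteAt (B̂ 0ℚ (approx k) 1⃗) i) on off
      where
      B̂-on : ∀ l → B̂ 0ℚ (approx k) 1⃗ l l ≡ (B (approx k) l l , η)
      B̂-on l with l ≟ᶠ l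
      ... | yes _ = cong (η *ℚ approx k l ,_) (ℚₚ.*-identityʳ η)
      ... | no ¬p = contradiction refl ¬p
      B̂-off : ∀ {l m} → l ≢ m → B̂ 0ℚ (approx k) 1⃗ l m ≡ (B (approx k) l m , 0ℚ)
      B̂-off {l} {m} l≢m with l ≟ᶠ m
      ... | yes p = contradiction p l≢m
      ... | no _  = refl
      on : ∀ j → deleteAt (B̂ 0ℚ (approx k) 1⃗) i j j ≡ (-ℚ seq (deleteAt A i j j) k , η)
      on j = trans (B̂-on (punchIn i j)) (cong (_, η) (-seq-A k (punchIn i j) (punchIn i j)))
      off : ∀ j l → j ≢ l → deleteAt (B̂ 0ℚ (approx k) 1⃗) i j l ≡ (-ℚ seq (deleteAt A i j l) k , 0ℚ)
      off j l j≢l = trans (B̂-off (j≢l ∘ punchIn-injective i j l))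
        (cong (_, 0ℚ) (-seq-A k (punchIn i j) (punchIn i l)))

    χ₀≃0 : coeff ℝ-rawRing χ 0 ≃ 0ℝ
    χ₀≃0 = half^-bounded⇒≃0 (coeff ℝ-rawRing χ 0) λ k → subst (λ z → ∣ z ∣ ≤ half^ k)
      (sym (trans (cong proj₁ (χ-truncated k)) (minor-eval-0 0ℚ (approx k) 1⃗ i))) (minor-residual k i)

    -- Direction `1⃗` in the first order estimate puts η χ₁ within ½ η of σ i η, whose absolute
    -- value is η; cancelling η leaves ½.
    χ₁-apart : ∀ k → ½ ≤ ∣ coeffAt k χ 1 ∣
    χ₁-apart k = ℚₚ.*-cancelˡ-≤-pos η {{positive 0<η}} (subst₂ _≤_ (ℚₚ.*-comm ½ η)
        (trans (ℚₚ.∣p*q∣≡∣p∣*∣q∣ η (coeffAt k χ 1)) (cong (_*ℚ ∣ coeffAt k χ 1 ∣) ∣η∣≡η))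
        (reverse-triangle (η *ℚ coeffAt k χ 1) y (ℚₚ.≤-reflexive (trans (half+half η) (sym ∣y∣≡η)))
          (subst (λ z → ∣ z -ℚ y ∣ ≤ ½ *ℚ η) (sym (cong proj₂ (χ-truncated k)))
            (minor^-near₂ ℚₚ.≤-refl 0≤1 (approx k) 1⃗ (Invariant.c-inBox (invariant k)) (λ _ → ℚₚ.≤-refl) i))))
      where
      y : ℚ
      y = σ i *ℚ (η *ℚ 1ℚ)
      ∣y∣≡η : ∣ y ∣ ≡ η
      ∣y∣≡η = trans (ℚₚ.∣p*q∣≡∣p∣*∣q∣ (σ i) (η *ℚ 1ℚ))
        (trans (cong₂ _*ℚ_ (∣sgn∣≡1 (matchingWithout i)) (trans (cong ∣_∣ (ℚₚ.*-identityʳ η)) ∣η∣≡η)) (ℚₚ.*-identityˡ η))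

    P-vertex : IsPVertex A i
    P-vertex = 0 , A-multiplicity , X∣ χ χ₀≃0 , X²∤ χ 0<½ χ₁-apart

  cover : HasPCover G 1
  cover = (λ _ → A) , record
    { distinct    = λ { fzero fzero _ → refl }
    ; inS         = λ _ → A∈S
    ; nonSingular = λ _ → nonsingular
    ; covers      = λ i → fzero , P-vertex i
    }

corollary1 : ∀ (n : ℕ) (G : Graph (suc n)) → PerfectMatching G → p[ G ]≡ [ 1 ]
corollary1 n G matching = Construction.cover (smallWeight n) G matching , at-least-one
  where
  at-least-one : ∀ l → HasPCover G l → 1 ≤ℕ l
  at-least-one zero    (_ , cover) with () ← proj₁ (IsPCover.covers cover fzero)
  at-least-one (suc l) _           = s≤s z≤n
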